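{- Let $G$ be a complete multipartite graph with independence number $m\geq 2$ and let $k_p$ denote the number of parts of $G$ of cardinality $p$ for $1\leq p\leq m$. If $$k_1-\sum_{p=2}^m\left(\frac{p^2}{2}-\frac{3p}{2}+1\right)k_p\geq 0,$$ then $G$ is on-line chromatic-choosable, i.e. $\chi_p(G)=\chi(G)$.
   Context: All graphs are finite and simple. The parts of a complete multipartite graph are its partite sets. $\chi(G)$ is the chromatic number. On-line $f$-list coloring game. Given a graph $G$ and an integer-valued function $f$ on $V(G)$, two players Alice and Bob play as follows. Initially all vertices are uncolored. In round $i$, Alice marks a nonempty subset $V_i$ of the remaining uncolored vertices (assigning color $i$ as a permissible color to each vertex of $V_i$); then Bob chooses an independent set $X_i\subseteq V_i$ and colors all vertices of $X_i$ with color $i$. If at the end of some round there is a vertex $v$ that has been marked $f(v)$ times but is not yet colored, Alice wins. Otherwise Bob wins, i.e. in the end each vertex $v$ is colored by Bob before running out of $f(v)$ permissible colors. $G$ is on-line $f$-choosable if Bob has a winning strategy, and on-line $k$-choosable if this holds for the constant function $f\equiv k$. The on-line choice number $\chi_p(G)$ (the subscript $p$ here is just notation) is the minimum $k$ such that $G$ is on-line $k$-choosable. $G$ is on-line chromatic-choosable if $\chi_p(G)=\chi(G)$. -}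

module Defs where

open import Data.Bool.Base using (if_then_else_)
open import Data.Fin.Base using (Fin; toℕ)
open import Data.Fin.Properties using (_≟_)
open import Data.Fin.Subset using (Subset; _∈_; _⊆_; _─_; Nonempty; ∣_∣; ⊤)
open import Data.Integer.Base using (+_)
open import Data.Nat.Base using (ℕ; suc; _≤_; _<_; _∸_)
open import Data.Product.Base using (∃; ∃-syntax; _×_)
open import Data.Rational.Base as ℚ using (ℚ; 1ℚ)
open import Data.Rational.Properties using (+-0-commutativeMonoid)
open import Data.Vec.Base using (lookup; tabulate)
open import Function.Bundles using (_⇔_)
open import Function.Definitions using (StrictlySurjective)
open import Level using (0ℓ)
open import Relation.Binary.Core using (Rel)
open import Relation.Binary.Definitions using (Decidable; Irreflexive; Symmetric)
open import Relation.Binary.PropositionalEquality.Core using (_≡_; _≢_)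
open import Relation.Nullary.Decidable.Core using (does)
open import Relation.Nullary.Negation.Core using (¬_)
open import Algebra.Properties.CommutativeMonoid.Sum +-0-commutativeMonoid using (sum)
import Data.Nat.Base as ℕ
import Data.Nat.Properties as ℕ

IsLeast : (ℕ → Set) → ℕ → Set
IsLeast P k = P k × (∀ j → P j → k ≤ j)

IsGreatest : (ℕ → Set) → ℕ → Set
IsGreatest P k = P k × (∀ j → P j → j ≤ k)

record Graph (n : ℕ) : Set₁ where
  field
    Adj    : Rel (Fin n) 0ℓ
    adj?   : Decidable Adj
    sym    : Symmetric Adj
    irrefl : Irreflexive _≡_ Adj

module _ {n : ℕ} (G : Graph n) where
  open Graph G

  Independent : Subset n → Set
  Independent S = ∀ {u v} → u ∈ S → v ∈ S → ¬ Adj u v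

  IsIndependenceNumber : ℕ → Set
  IsIndependenceNumber = IsGreatest (λ a → ∃[ S ] Independent S × ∣ S ∣ ≡ a)

  Colourable : ℕ → Set
  Colourable k = ∃ λ (c : Fin n → Fin k) → ∀ {u v} → Adj u v → c u ≢ c v

  IsChromaticNumber : ℕ → Set
  IsChromaticNumber = IsLeast Colourable

mark : ∀ {n} → Subset n → (Fin n → ℕ) → (Fin n → ℕ)
mark V marks v = if lookup V v then suc (marks v) else marks v

-- Bob has a winning strategy from the position in which U is the set of
-- uncoloured vertices and each v has been marked (marks v) times.  Every play
-- is finite, because each round marks an uncoloured vertex and no uncoloured
-- v can be marked f v times without Alice winning; hence an inductive type.
-- The first premise is also imposed before the first round, so a vertex with
-- f v = 0 is out of permissible colours from the start.
data BobWins {n : ℕ} (G : Graph n) (f : Fin n → ℕ)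
             (U : Subset n) (marks : Fin n → ℕ) : Set where
  bobWins :
    (∀ {v} → v ∈ U → marks v < f v) →
    (∀ V → Nonempty V → V ⊆ U →
       ∃[ X ] X ⊆ V × Independent G X × BobWins G f (U ─ X) (mark V marks)) →
    BobWins G f U marks

module _ {n : ℕ} (G : Graph n) where

  OnlineChoosable : (Fin n → ℕ) → Set
  OnlineChoosable f = BobWins G f ⊤ (λ _ → 0)

  IsOnlineChoiceNumber : ℕ → Set
  IsOnlineChoiceNumber = IsLeast (λ k → OnlineChoosable (λ _ → k))

  OnlineChromaticChoosable : Set
  OnlineChromaticChoosable = ∃[ k ] IsOnlineChoiceNumber k × IsChromaticNumber G k

record CompleteMultipartite {n : ℕ} (G : Graph n) : Set where
  open Graph G
  field
    #parts   : ℕ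
    part     : Fin n → Fin #parts
    nonempty : StrictlySurjective _≡_ part
    adj⇔     : ∀ u v → Adj u v ⇔ part u ≢ part v

  partiteSet : Fin #parts → Subset n
  partiteSet i = tabulate (λ v → does (part v ≟ i))

  #partsOfSize : ℕ → ℕ
  #partsOfSize p = ∣ tabulate (λ i → does (∣ partiteSet i ∣ ℕ.≟ p)) ∣

fromℕ : ℕ → ℚ
fromℕ a = + a ℚ./ 1

-- ∑ f(p) over 2 ≤ p ≤ m
∑₂ : ℕ → (ℕ → ℚ) → ℚ
∑₂ m f = sum {m ∸ 1} (λ i → f (2 ℕ.+ toℕ i))

-- p²/2 − 3p/2 + 1
coeff : ℕ → ℚ
coeff p = (+ (p ℕ.^ 2) ℚ./ 2) ℚ.- (+ (3 ℕ.* p) ℚ./ 2) ℚ.+ 1ℚ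

{-# OPTIONS --safe #-}

-- Bob keeps a list of untouched parts, of sizes r ≥ 2, and an ordered list of
-- singles: vertices of touched parts, treated as if pairwise adjacent.  Each
-- single has a level, and levels decrease along the list.  Let g v be the
-- number of marks v can still take.  Bob maintains that every set of j + 1
-- vertices in one part has total g at least
--   R j = ∑_parts demand r j + ∑_singles min(j, level)
-- and that a single of level q with c singles before it has
--   g > ∑_parts slot r q + c,
-- where demand r j = 1 + ∑_{1≤i≤j} max(r − i, 1) and slot r q = max(r − q, 1).
-- The initial position, with the parts of size 1 as singles of maximal level,
-- satisfies this because demand r j ≤ j + 1 + (r − 1)(r − 2)/2.
--
-- Bob's answer to a marked set V:
--  * If some Q ⊆ V of size i + 1 within one part is tight (total g equal to
--    R i), take i maximal and colour all marked vertices of that part.  By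
--    tightness each remaining vertex has g ≥ R (i + 1) − R i, which is exactly
--    what the remaining vertices need to become the last singles of level i + 1.
--  * Otherwise let q be the level of the first marked single (0 if there is
--    none).  If no part has more than q marked vertices, colour that single.
--  * Otherwise colour the marked vertices of the part with the most of them.
--    What remains is again an untouched part, or, if only one vertex is left,
--    becomes the first single, of maximal level.
-- For the lower bounds, G needs one colour per part, and marking all uncoloured
-- vertices in every round turns a winning strategy of Bob into a colouring.
module Submission where

open import Defs
open import Data.Bool.Base using (true; false)
open import Data.Fin.Base using (Fin; zero; suc; toℕ; fromℕ<)
import Data.Fin.Properties as Fin
open import Data.Fin.Subset as Subset using (Subset; outside; _─_; ∣_∣; ⊤)
open import Data.Fin.Subset.Properties using (_∈?_; p─q⊆p; x∈p∧x∉q⇒x∈p─q; nonempty?; ∈⊤)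
open import Data.Integer.Base as ℤ using () renaming (+_ to pos)
import Data.Integer.Properties as ℤ
import Data.Integer.Tactic.RingSolver as ℤ
open import Data.List.Base as List using (List; []; _∷_; _++_; map; length; filter; concat; allFin)
import Data.List.Membership.DecPropositional as DecMembership
open import Data.List.Membership.Propositional using (_∈_; _∉_; lose; find)
open import Data.List.Membership.Propositional.Properties
  using (∈-∃++; ∈-filter⁺; ∈-filter⁻; ∈-length; ∈-map⁺; ∈-map⁻; ∈-allFin; ∈-concat⁺′)
open import Data.List.Properties
  using (map-++; length-++; length-map; filter-all; filter-notAll; length-filter; filter-none;
         length-tabulate; ++-identityʳ)
open import Data.List.Relation.Binary.Permutation.Propositional using (_↭_; ↭-sym)
open import Data.List.Relation.Binary.Permutation.Propositional.Properties as Perm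
  using (shift; All-resp-↭; Any-resp-↭)
open import Data.List.Relation.Binary.Sublist.Propositional as Sublist using (_⊆_; []; _∷_; _∷ʳ_; ⊆-trans)
open import Data.List.Relation.Binary.Sublist.Propositional.Properties
  using (filter-⊆; filter⁺; length-mono-≤; All-resp-⊆)
open import Data.List.Relation.Unary.All as All using (All; []; _∷_)
import Data.List.Relation.Unary.All.Properties as All
open import Data.List.Relation.Unary.Any as Any using (Any; here; there)
import Data.List.Relation.Unary.Any.Properties as Any
open import Data.Nat.Base
  using (ℕ; zero; suc; _+_; _*_; _∸_; _⊔_; _⊓_; _^_; _≤_; _<_; z≤n; s≤s; z<s)
open import Data.Nat.ListAction using (sum)
open import Data.Nat.ListAction.Properties using (sum-++; sum-↭)
open import Data.Nat.Properties
open import Data.Nat.Tactic.RingSolver using (solve-∀)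
open import Data.Product.Base using (Σ-syntax; ∃-syntax; _×_; _,_; proj₁; proj₂)
open import Data.Rational.Base as ℚ using (0ℚ; 1ℚ)
import Data.Rational.Properties as ℚ
open import Data.Rational.Unnormalised.Base as ℚᵘ using (mkℚᵘ; *≡*; *≤*)
import Data.Rational.Unnormalised.Properties as ℚᵘ
open import Data.Sum.Base using (_⊎_; inj₁; inj₂; [_,_]′)
open import Data.Vec.Base as Vec using (_∷_; here; there)
open import Data.Vec.Properties using (lookup∘tabulate; []=⇒lookup; lookup⇒[]=)
open import Function.Base using (_∘_; id)
open import Function.Bundles using (Equivalence)
open import Level using (0ℓ)
open import Relation.Binary.PropositionalEquality using (_≡_; _≢_; refl; sym; trans; cong; cong₂; subst)
open import Relation.Nullary using (¬_; Dec; does; yes; no; contradiction; ¬?)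
open import Relation.Nullary.Decidable using (map′; _×-dec_; decidable-stable; dec-true)
open import Relation.Unary using (Pred; Decidable)
open import Algebra.Properties.CommutativeMonoid.Sum +-0-commutativeMonoid using () renaming (sum to ∑ᶠ)
open import Algebra.Properties.CommutativeMonoid.Sum ℚ.+-0-commutativeMonoid using ()
  renaming (sum to ∑ℚ; sum-cong-≗ to ∑ℚ-cong)

-- Demands of the parts

slot : ℕ → ℕ → ℕ
slot r q = (r ∸ q) ⊔ 1

demand : ℕ → ℕ → ℕ
demand r zero    = 1
demand r (suc j) = demand r j + slot r (suc j)

1≤slot : ∀ r q → 1 ≤ slot r q
1≤slot r q = m≤n⊔m (r ∸ q) 1

slot-≥ : ∀ {d q r} → d + q ≤ r → d ≤ slot r q
slot-≥ {d} d+q≤r = m≤n⇒m≤n⊔o 1 (m+n≤o⇒m≤o∸n d d+q≤r)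

slot-mono : ∀ {d r} q → d ≤ r → slot d q ≤ slot r q
slot-mono q d≤r = ⊔-monoˡ-≤ 1 (∸-monoˡ-≤ q d≤r)

-- Both arguments of the maximum in `slot d q` are at most `d`, whereas `r ∸ q` exceeds `d`. The
-- strict drop pays for the mark on a single of level `q` when `x` vertices of a part get coloured.
slot-gap : ∀ {d x r q} → 1 ≤ d → d + x ≤ r → q < x → slot d q < slot r q
slot-gap {d} {x} {r} {q} 1≤d d+x≤r q<x = begin-strict
  slot d q  ≤⟨ ⊔-lub (m∸n≤m d q) 1≤d ⟩
  d         <⟨ slot-≥ {suc d} {q} (≤-trans (≤-reflexive (sym (+-suc d q))) (≤-trans (+-monoʳ-≤ d q<x) d+x≤r)) ⟩
  slot r q  ∎
  where open ≤-Reasoning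

j<demand : ∀ r j → j < demand r j
j<demand r zero    = z<s
j<demand r (suc j) = ≤-trans (≤-reflexive (+-comm 1 (suc j))) (+-mono-≤ (j<demand r j) (1≤slot r (suc j)))

demand-mono : ∀ {d r} j → d ≤ r → demand d j ≤ demand r j
demand-mono zero    d≤r = ≤-refl
demand-mono (suc j) d≤r = +-mono-≤ (demand-mono j d≤r) (slot-mono (suc j) d≤r)

-- Each slot of index at most `j < q` is at least `d + 1`. The left side is the cost of colouring a
-- tight part: `d` new singles of level `q` add `d * j` to the bound, and `j + 1` vertices may be
-- marked.
demand-below : ∀ {d q r} j → j < q → d + q ≤ r → d * j + suc j ≤ demand r j
demand-below {d} zero    _   _ = ≤-reflexive (cong (_+ 1) (*-zeroʳ d))
demand-below {d} {q} {r} (suc j) j<q d+q≤r = begin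
  d * suc j + suc (suc j)      ≡⟨ eq d j ⟩
  (d * j + suc j) + suc d      ≤⟨ +-mono-≤ (demand-below j (<-trans (n<1+n j) j<q) d+q≤r) (slot-≥ {suc d} {suc j} le) ⟩
  demand r j + slot r (suc j)  ∎
  where
  open ≤-Reasoning
  eq : ∀ d j → d * suc j + suc (suc j) ≡ (d * j + suc j) + suc d
  eq = solve-∀
  le : suc d + suc j ≤ r
  le = ≤-trans (≤-reflexive (sym (+-suc d (suc j)))) (≤-trans (+-monoʳ-≤ d j<q) d+q≤r)

-- The first `i` slots are at least `d + 1`, the next at least `d`, all others at least 1. This
-- covers `j` marks only; when all `j + 1` vertices are marked, the missing unit comes from the set
-- not being tight.
demand-above : ∀ {d i r} j → i < j → d + suc i ≤ r → d * suc i + j ≤ demand r j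
demand-above {d} {i} {r} (suc j) (s≤s i≤j) d+q≤r with m≤n⇒m<n∨m≡n i≤j
... | inj₁ i<j = begin
  d * suc i + suc j            ≡⟨ eq (d * suc i) j ⟩
  (d * suc i + j) + 1          ≤⟨ +-mono-≤ (demand-above j i<j d+q≤r) (1≤slot r (suc j)) ⟩
  demand r j + slot r (suc j)  ∎
  where
  open ≤-Reasoning
  eq : ∀ x j → x + suc j ≡ (x + j) + 1
  eq = solve-∀
... | inj₂ refl = begin
  d * suc i + suc i            ≡⟨ eq d i ⟩
  (d * i + suc i) + d          ≤⟨ +-mono-≤ (demand-below i (n<1+n i) d+q≤r) (slot-≥ d+q≤r) ⟩
  demand r i + slot r (suc i)  ∎
  where
  open ≤-Reasoning
  eq : ∀ d i → d * suc i + suc i ≡ (d * i + suc i) + d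
  eq = solve-∀

-- The first slot alone gains `x`: it is `d − 1` for size `d ≥ 2` and at least `d + x − 1` for size
-- `r`. Later slots are monotone in the size. For `d = 1` the maximum with 1 spoils this, hence
-- `demand-last`.
demand-gap : ∀ {d x r} j → 2 ≤ d → d + x ≤ r → demand d (suc j) + x ≤ demand r (suc j)
demand-gap {suc d} {x} {r} zero (s≤s 1≤d) d+x≤r = s≤s (begin
  (d ⊔ 1) + x  ≡⟨ cong (_+ x) (m≥n⇒m⊔n≡m 1≤d) ⟩
  d + x        ≤⟨ slot-≥ {d + x} {1} (≤-trans (≤-reflexive (+-comm (d + x) 1)) d+x≤r) ⟩
  slot r 1     ∎)
  where open ≤-Reasoning
demand-gap {d} {x} {r} (suc j) 2≤d d+x≤r = begin
  (demand d (suc j) + slot d (2 + j)) + x  ≡⟨ eq (demand d (suc j)) (slot d (2 + j)) x ⟩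
  (demand d (suc j) + x) + slot d (2 + j)  ≤⟨ +-mono-≤ (demand-gap j 2≤d d+x≤r) (slot-mono (2 + j) (m+n≤o⇒m≤o d d+x≤r)) ⟩
  demand r (suc j) + slot r (2 + j)        ∎
  where
  open ≤-Reasoning
  eq : ∀ a b c → (a + b) + c ≡ (a + c) + b
  eq = solve-∀

-- The counterpart of `demand-gap` for one remaining vertex: as a single it adds at most `suc j` to
-- the bound, one less than `demand 1 (suc j)`.
demand-last : ∀ {x r} j → suc x ≤ r → suc j + x ≤ demand r (suc j)
demand-last {x} {r} zero    x<r = s≤s (slot-≥ {x} {1} (≤-trans (≤-reflexive (+-comm x 1)) x<r))
demand-last {x} {r} (suc j) x<r = begin
  suc (suc j) + x                    ≡⟨ +-comm 1 (suc j + x) ⟩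
  (suc j + x) + 1                    ≤⟨ +-mono-≤ (demand-last j x<r) (1≤slot r (2 + j)) ⟩
  demand r (suc j) + slot r (2 + j)  ∎
  where open ≤-Reasoning

-- The binomial coefficient `s` choose 2; for `p ≥ 2`, `triangle (p ∸ 1)` is the coefficient of the
-- number of parts of size `p` in the hypothesis.
triangle : ℕ → ℕ
triangle zero    = 0
triangle (suc s) = s + triangle s

-- The excesses of the slots over 1 are `r − 1`, `r − 2` and so on down to 0. The induction keeps
-- `triangle (r ∸ j)`, the sum of the excesses still to come, on the left.
demand-triangle : ∀ r j → demand (suc r) j ≤ suc j + triangle r
demand-triangle r j = m+n≤o⇒m≤o (demand (suc r) j) (go j)
  where
  open ≤-Reasoning
  step : ∀ s → (s ⊔ 1) + triangle (s ∸ 1) ≤ 1 + triangle s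
  step zero    = ≤-refl
  step (suc s) = s≤s (+-monoˡ-≤ (triangle s) (≤-reflexive (m≥n⇒m⊔n≡m {s} z≤n)))
  go : ∀ j → demand (suc r) j + triangle (r ∸ j) ≤ suc j + triangle r
  go zero    = ≤-refl
  go (suc j) = begin
    (demand (suc r) j + slot (suc r) (suc j)) + triangle (r ∸ suc j)
      ≡⟨ +-assoc (demand (suc r) j) _ _ ⟩
    demand (suc r) j + (((r ∸ j) ⊔ 1) + triangle (r ∸ suc j))
      ≡⟨ cong (λ t → demand (suc r) j + (((r ∸ j) ⊔ 1) + triangle t))
           (trans (cong (r ∸_) (+-comm 1 j)) (sym (∸-+-assoc r j 1))) ⟩
    demand (suc r) j + (((r ∸ j) ⊔ 1) + triangle (r ∸ j ∸ 1))
      ≤⟨ +-monoʳ-≤ (demand (suc r) j) (step (r ∸ j)) ⟩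
    demand (suc r) j + (1 + triangle (r ∸ j))
      ≡⟨ +-suc _ _ ⟩
    suc (demand (suc r) j + triangle (r ∸ j))
      ≤⟨ s≤s (go j) ⟩
    suc (suc j) + triangle r ∎

-- Sums and sublists

∑ : {B : Set} → (B → ℕ) → List B → ℕ
∑ f = sum ∘ map f

module _ {B : Set} where

  ∑-++ : ∀ (f : B → ℕ) xs ys → ∑ f (xs ++ ys) ≡ ∑ f xs + ∑ f ys
  ∑-++ f xs ys = trans (cong sum (map-++ f xs ys)) (sum-++ (map f xs) (map f ys))

  ∑-↭ : ∀ (f : B → ℕ) {xs ys} → xs ↭ ys → ∑ f xs ≡ ∑ f ys
  ∑-↭ f p = sum-↭ (Perm.map⁺ f p)

  ∑-mono : ∀ {f h : B → ℕ} → (∀ x → f x ≤ h x) → ∀ xs → ∑ f xs ≤ ∑ h xs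
  ∑-mono f≤h []       = z≤n
  ∑-mono f≤h (x ∷ xs) = +-mono-≤ (f≤h x) (∑-mono f≤h xs)

  ∑-+ : ∀ (f h : B → ℕ) xs → ∑ (λ x → f x + h x) xs ≡ ∑ f xs + ∑ h xs
  ∑-+ f h []       = refl
  ∑-+ f h (x ∷ xs) = trans (cong (f x + h x +_) (∑-+ f h xs)) (eq (f x) (h x) (∑ f xs) (∑ h xs))
    where
    eq : ∀ a b c d → (a + b) + (c + d) ≡ (a + c) + (b + d)
    eq = solve-∀

  ∑-const : ∀ {f : B → ℕ} {c xs} → All (λ x → f x ≡ c) xs → ∑ f xs ≡ length xs * c
  ∑-const []         = refl
  ∑-const (eq ∷ eqs) = cong₂ _+_ eq (∑-const eqs)

  pick : ∀ {x : B} {xs} → x ∈ xs → ∃[ ys ] xs ↭ x ∷ ys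
  pick {x} x∈xs with ∈-∃++ x∈xs
  ... | as , bs , refl = as ++ bs , shift x as bs

  anySublist? : {P : List B → Set} → (∀ Q → Dec (P Q)) → ∀ xs → Dec (∃[ Q ] Q ⊆ xs × P Q)
  anySublist? P? []       = map′ (λ p → [] , [] , p) (λ { ([] , [] , p) → p }) (P? [])
  anySublist? P? (x ∷ xs) with anySublist? P? xs | anySublist? (P? ∘ (x ∷_)) xs
  ... | yes (Q , Q⊆ , p) | _                = yes (Q , x ∷ʳ Q⊆ , p)
  ... | no _             | yes (Q , Q⊆ , p) = yes (x ∷ Q , refl ∷ Q⊆ , p)
  ... | no ¬without      | no ¬with         = no λ where
    (Q      , _ ∷ʳ Q⊆   , p) → ¬without (Q , Q⊆ , p)
    (_ ∷ Q  , refl ∷ Q⊆ , p) → ¬with (Q , Q⊆ , p)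

  -- Sublists play the role of subsets, so `u` is inserted at its place in `P`. This enlarges a
  -- tight set by one unmarked vertex to a set to which richness applies.
  extend : ∀ (g : B → ℕ) {Q P u} → Q ⊆ P → u ∈ P → u ∉ Q →
           ∃[ Q′ ] Q′ ⊆ P × length Q′ ≡ suc (length Q) × ∑ g Q′ ≡ ∑ g Q + g u
  extend g {Q} (y ∷ʳ Q⊆P)   (here refl)  u∉Q = y ∷ Q , refl ∷ Q⊆P , refl , +-comm (g y) (∑ g Q)
  extend g     (y ∷ʳ Q⊆P)   (there u∈P)  u∉Q with extend g Q⊆P u∈P u∉Q
  ... | Q′ , Q′⊆P , len , eq = Q′ , y ∷ʳ Q′⊆P , len , eq
  extend g     (refl ∷ Q⊆P) (here refl)  u∉Q = contradiction (here refl) u∉Q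
  extend g {y ∷ Q} (refl ∷ Q⊆P) (there u∈P) u∉Q with extend g Q⊆P u∈P (u∉Q ∘ there)
  ... | Q′ , Q′⊆P , len , eq =
    y ∷ Q′ , refl ∷ Q′⊆P , cong suc len , trans (cong (g y +_) eq) (sym (+-assoc (g y) _ _))

  length-filter-¬ : {P : Pred B 0ℓ} (P? : Decidable P) → ∀ xs →
                    length (filter (¬? ∘ P?) xs) + length (filter P? xs) ≡ length xs
  length-filter-¬ P? [] = refl
  length-filter-¬ P? (x ∷ xs) with P? x
  ... | yes _ = trans (+-suc _ _) (cong suc (length-filter-¬ P? xs))
  ... | no _  = cong suc (length-filter-¬ P? xs)

  maximum : ∀ (f : B → ℕ) {z xs} → z ∈ xs → ∃[ x ] x ∈ xs × All (λ y → f y ≤ f x) xs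
  maximum f {xs = x ∷ []} _ = x , here refl , ≤-refl ∷ []
  maximum f {xs = x ∷ xs@(_ ∷ _)} _ with maximum f {xs = xs} (here refl)
  ... | y , y∈xs , fy≥ with ≤-total (f x) (f y)
  ... | inj₁ fx≤fy = y , there y∈xs , fx≤fy ∷ fy≥
  ... | inj₂ fy≤fx = x , here refl , ≤-refl ∷ All.map (λ le → ≤-trans le fy≤fx) fy≥

greatest : {P : Pred ℕ 0ℓ} → Decidable P → ∀ b → (∀ {j} → b ≤ j → ¬ P j) →
           (∃[ i ] P i × (∀ {j} → i < j → ¬ P j)) ⊎ (∀ {j} → ¬ P j)
greatest P? zero    none = inj₂ (none z≤n)
greatest P? (suc b) none with P? b
... | yes p = inj₁ (b , p , none)
... | no ¬p = greatest P? b λ b≤j → [ none , (λ { refl → ¬p }) ]′ (m≤n⇒m<n∨m≡n b≤j)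

-- Bob's strategy

module Strategy {A : Set} (Adj : A → A → Set) (irrefl : ∀ {v} → ¬ Adj v v) (N : ℕ) where

  private
    Part   = List A
    Single = ℕ × A

  level : Single → ℕ
  level = proj₁

  bound : List Part → List Single → ℕ → ℕ
  bound Ps Ts j = ∑ (λ P → demand (length P) j) Ps + ∑ (λ t → j ⊓ level t) Ts

  rounds : List Part → ℕ → ℕ
  rounds Ps q = ∑ (λ P → slot (length P) q) Ps

  size : List Part → List Single → ℕ
  size Ps Ts = ∑ length Ps + length Ts

  Independentₗ : List A → Set
  Independentₗ P = ∀ {u v} → u ∈ P → v ∈ P → ¬ Adj u v

  record Proper (P : Part) : Set where
    constructor proper
    field
      large : 2 ≤ length P
      small : length P ≤ N
      indep : Independentₗ P

  data Settled (w : ℕ → ℕ) (g : A → ℕ) : ℕ → List Single → Set where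
    []  : ∀ {c} → Settled w g c []
    _∷_ : ∀ {c q u Ts} → w q + c < g u → Settled w g (suc c) Ts → Settled w g c ((q , u) ∷ Ts)

  data Descending : ℕ → List Single → Set where
    []  : ∀ {b} → Descending b []
    _∷_ : ∀ {b q u Ts} → q ≤ b → Descending q Ts → Descending b ((q , u) ∷ Ts)

  Rich : (A → ℕ) → (ℕ → ℕ) → Part → Set
  Rich g R P = ∀ Q j → Q ⊆ P → length Q ≡ suc j → R j ≤ ∑ g Q

  record Safe (g : A → ℕ) (Ps : List Part) (Ts : List Single) : Set where
    field
      allProper  : All Proper Ps
      rich       : All (Rich g (bound Ps Ts)) Ps
      settled    : Settled (rounds Ps) g 0 Ts
      descending : Descending N Ts

  Covered : A → List Part → List Single → Set
  Covered v Ps Ts = Any (v ∈_) Ps ⊎ Any (λ t → v ≡ proj₂ t) Ts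

  bound-↭ : ∀ {Ps Ps′ Ts} → Ps ↭ Ps′ → ∀ j → bound Ps Ts j ≡ bound Ps′ Ts j
  bound-↭ {Ts = Ts} p j = cong (_+ ∑ (λ t → j ⊓ level t) Ts) (∑-↭ _ p)

  Settled-resp : ∀ {w w′ g c Ts} → (∀ q → w q ≡ w′ q) → Settled w g c Ts → Settled w′ g c Ts
  Settled-resp eq [] = []
  Settled-resp {g = g} eq (_∷_ {c} {q} {u} lt s) = subst (λ x → x + c < g u) (eq q) lt ∷ Settled-resp eq s

  Safe-↭ : ∀ {g Ps Ps′ Ts} → Ps ↭ Ps′ → Safe g Ps Ts → Safe g Ps′ Ts
  Safe-↭ {g} {Ts = Ts} p s = record
    { allProper  = All-resp-↭ p allProper
    ; rich       = All-resp-↭ p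
        (All.map (λ r Q j Q⊆P len → ≤-trans (≤-reflexive (sym (bound-↭ {Ts = Ts} p j))) (r Q j Q⊆P len)) rich)
    ; settled    = Settled-resp (λ q → ∑-↭ _ p) settled
    ; descending = descending
    } where open Safe s

  Settled-++⁺ : ∀ {w g c} xs {ys} → Settled w g c xs → Settled w g (length xs + c) ys → Settled w g c (xs ++ ys)
  Settled-++⁺ []       []      t = t
  Settled-++⁺ {w} {g} {c} (_ ∷ xs) {ys} (p ∷ s) t =
      p ∷ Settled-++⁺ xs s (subst (λ c → Settled w g c ys) (sym (+-suc (length xs) c)) t)

  Settled-++⁻ : ∀ {w g c} xs {ys} → Settled w g c (xs ++ ys) → Settled w g c xs × Settled w g (length xs + c) ys
  Settled-++⁻ []       t       = [] , t
  Settled-++⁻ {w} {g} {c} (_ ∷ xs) {ys} (p ∷ t) with Settled-++⁻ xs t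
  ... | s , s′ = p ∷ s , subst (λ c → Settled w g c ys) (+-suc (length xs) c) s′

  label : ℕ → List A → List Single
  label q = map (q ,_)

  length-label : ∀ q us → length (label q us) ≡ length us
  length-label q us = length-map (λ u → (q , u)) us

  Settled-const : ∀ {w g q b} us c → All (λ u → b ≤ g u) us → w q + (c + length us) ≤ b →
                  Settled w g c (label q us)
  Settled-const [] c _ _ = []
  Settled-const {w} {g} {q} {b} (u ∷ us) c (b≤gu ∷ b≤g) le =
      ≤-trans (≤-trans lt le) b≤gu ∷ Settled-const us (suc c) b≤g le′
    where
    lt : w q + c < w q + (c + suc (length us))
    lt = +-monoʳ-< (w q) (m<m+n c z<s)
    le′ : w q + (suc c + length us) ≤ b
    le′ = subst (λ x → w q + x ≤ b) (+-suc c (length us)) le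

  Settled⇒positive : ∀ {w g c Ts v} → Settled w g c Ts → Any (λ t → v ≡ proj₂ t) Ts → 0 < g v
  Settled⇒positive (lt ∷ _) (here refl) = ≤-<-trans z≤n lt
  Settled⇒positive (_ ∷ s)  (there v∈)  = Settled⇒positive s v∈

  Descending-weaken : ∀ {b b′ Ts} → b ≤ b′ → Descending b Ts → Descending b′ Ts
  Descending-weaken b≤b′ []        = []
  Descending-weaken b≤b′ (q≤b ∷ d) = ≤-trans q≤b b≤b′ ∷ d

  Descending⇒All : ∀ {b Ts} → Descending b Ts → All (λ t → level t ≤ b) Ts
  Descending⇒All []        = []
  Descending⇒All (q≤b ∷ d) = q≤b ∷ All.map (λ le → ≤-trans le q≤b) (Descending⇒All d)

  Descending-const : ∀ {q Ts} us → Descending q Ts → Descending q (label q us ++ Ts)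
  Descending-const []       d = d
  Descending-const (_ ∷ us) d = ≤-refl ∷ Descending-const us d

  -- The vertices left over from a tight part enter between `hi` and `lo`, behind every existing
  -- single of level `q`. That `lo<` is strict gives the singles of `lo` the room to be delayed.
  record Split (b q : ℕ) (Ts : List Single) : Set where
    field
      {hi lo}  : List Single
      split    : Ts ≡ hi ++ lo
      hi≥      : All (λ t → q ≤ level t) hi
      lo<      : All (λ t → level t < q) lo
      inserted : ∀ us → Descending b (hi ++ label q us ++ lo)

  splitAt : ∀ {b Ts} q → q ≤ b → Descending b Ts → Split b q Ts
  splitAt q q≤b [] =
      record { split = refl ; hi≥ = [] ; lo< = [] ; inserted = λ us → Descending-weaken q≤b (Descending-const us []) }
  splitAt {Ts = (l , u) ∷ Ts} q q≤b (l≤b ∷ d) with q ≤? l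
  ... | yes q≤l = record
    { split = cong ((l , u) ∷_) split ; hi≥ = q≤l ∷ hi≥ ; lo< = lo< ; inserted = λ us → l≤b ∷ inserted us }
    where open Split (splitAt q q≤l d)
  ... | no q≰l = record
    { hi = [] ; split = refl ; hi≥ = [] ; lo< = All.map (λ le → ≤-<-trans le l<q) (Descending⇒All (≤-refl ∷ d))
    ; inserted = λ us → Descending-weaken q≤b (Descending-const us (<⇒≤ l<q ∷ d)) }
    where
    l<q : l < q
    l<q = ≰⇒> q≰l

  -- From `j` to `suc j` each part contributes its next slot and each single of level above `j` one
  -- more. Hence a vertex extending a tight set of size `suc j` has at least
  -- `rounds Ps (suc j) + length hi` marks left.
  bound-suc : ∀ Ps {hi lo} j → All (λ t → suc j ≤ level t) hi →
              bound Ps (hi ++ lo) j + (rounds Ps (suc j) + length hi) ≤ bound Ps (hi ++ lo) (suc j)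
  bound-suc Ps {hi} {lo} j hi≥ = begin
    (D j + T j (hi ++ lo)) + (rounds Ps (suc j) + length hi)
      ≡⟨ cong (λ x → (D j + x) + (rounds Ps (suc j) + length hi)) (∑-++ _ hi lo) ⟩
    (D j + (T j hi + T j lo)) + (rounds Ps (suc j) + length hi)
      ≡⟨ eq (D j) (T j hi) (T j lo) (rounds Ps (suc j)) (length hi) ⟩
    (D j + rounds Ps (suc j)) + ((T j hi + length hi) + T j lo)
      ≤⟨ +-mono-≤ (≤-reflexive (sym (∑-+ _ _ Ps)))
          (+-mono-≤ (rise hi≥) (∑-mono (λ t → ⊓-monoˡ-≤ (level t) (n≤1+n j)) lo)) ⟩
    D (suc j) + (T (suc j) hi + T (suc j) lo)
      ≡⟨ cong (D (suc j) +_) (sym (∑-++ _ hi lo)) ⟩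
    D (suc j) + T (suc j) (hi ++ lo) ∎
    where
    open ≤-Reasoning
    D : ℕ → ℕ
    D j = ∑ (λ P → demand (length P) j) Ps
    T : ℕ → List Single → ℕ
    T j = ∑ (λ t → j ⊓ level t)
    eq : ∀ a b c d e → (a + (b + c)) + (d + e) ≡ (a + d) + ((b + e) + c)
    eq = solve-∀
    eq′ : ∀ a b c → (a + b) + suc c ≡ suc a + (b + c)
    eq′ = solve-∀
    rise : ∀ {xs} → All (λ t → suc j ≤ level t) xs → T j xs + length xs ≤ T (suc j) xs
    rise [] = z≤n
    rise {t ∷ xs} (le ∷ les) = begin
      (j ⊓ level t + T j xs) + suc (length xs)  ≡⟨ eq′ (j ⊓ level t) (T j xs) (length xs) ⟩
      suc (j ⊓ level t) + (T j xs + length xs)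
          ≤⟨ +-mono-≤ (⊓-glb (s≤s (m⊓n≤m j (level t))) (≤-trans (s≤s (m⊓n≤m j (level t))) le)) (rise les) ⟩
      suc j ⊓ level t + T (suc j) xs            ∎

  filter-indep : {B : Pred A 0ℓ} (B? : Decidable B) → ∀ {P} → Independentₗ P → Independentₗ (filter B? P)
  filter-indep B? ind u∈ v∈ = ind (proj₁ (∈-filter⁻ B? u∈)) (proj₁ (∈-filter⁻ B? v∈))

  rounds-N : ∀ {Ps} → All Proper Ps → rounds Ps N ≡ length Ps * 1
  rounds-N = ∑-const ∘ All.map λ p → m≤n⇒m⊔n≡n (≤-trans (≤-reflexive (m≤n⇒m∸n≡0 (Proper.small p))) z≤n)

  -- One round: a marked set and its effect on the invariant

  module Round (hit : Pred A 0ℓ) (hit? : Decidable hit)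
               (g g′ : A → ℕ) (g≤1+g′ : ∀ v → g v ≤ suc (g′ v)) (g≤g′ : ∀ {v} → ¬ hit v → g v ≤ g′ v) where

    marked unmarked : Part → Part
    marked   = filter hit?
    unmarked = filter (¬? ∘ hit?)

    hits : Part → ℕ
    hits = length ∘ marked

    record Reply (Ps : List Part) (Ts : List Single) : Set where
      field
        {chosen} : List A
        {Ps′}    : List Part
        {Ts′}    : List Single
        legal    : All hit chosen
        indep    : Independentₗ chosen
        cover    : ∀ {v} → Covered v Ps Ts → v ∈ chosen ⊎ Covered v Ps′ Ts′
        safe     : Safe g′ Ps′ Ts′
        shrink   : size Ps′ Ts′ < size Ps Ts

    Reply-↭ : ∀ {Ps Ps′ Ts} → Ps ↭ Ps′ → Reply Ps′ Ts → Reply Ps Ts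
    Reply-↭ {Ts = Ts} p r = record
      { legal = legal ; indep = indep ; safe = safe
      ; cover = λ { (inj₁ v∈) → cover (inj₁ (Any-resp-↭ p v∈)) ; (inj₂ v∈) → cover (inj₂ v∈) }
      ; shrink = subst (λ x → size Ps′ Ts′ < x + length Ts) (∑-↭ length (↭-sym p)) shrink }
      where open Reply r

    loss : ∀ Q → ∑ g Q ≤ ∑ g′ Q + hits Q
    loss [] = z≤n
    loss (v ∷ Q) with hit? v
    ... | yes _ = begin
      g v + ∑ g Q                      ≤⟨ +-mono-≤ (g≤1+g′ v) (loss Q) ⟩
      suc (g′ v) + (∑ g′ Q + hits Q)   ≡⟨ eq (g′ v) (∑ g′ Q) (hits Q) ⟩
      (g′ v + ∑ g′ Q) + suc (hits Q)   ∎
      where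
      open ≤-Reasoning
      eq : ∀ a b c → suc a + (b + c) ≡ (a + b) + suc c
      eq = solve-∀
    ... | no ¬h = ≤-trans (+-mono-≤ (g≤g′ ¬h) (loss Q)) (≤-reflexive (sym (+-assoc (g′ v) _ _)))

    hits-mono : ∀ {Q P} → Q ⊆ P → hits Q ≤ hits P
    hits-mono Q⊆P = length-mono-≤ (filter⁺ hit? hit? (λ { refl h → h }) Q⊆P)

    -- A set with an unmarked vertex loses at most `j`. A fully marked set that is not tight has a
    -- spare unit, which pays for its last mark.
    hits-or-all : ∀ {Q P j} → Q ⊆ P → length Q ≡ suc j → hits Q ≤ j ⊎ Q ⊆ marked P
    hits-or-all {Q} Q⊆P len with All.all? hit? Q
    ... | yes all = inj₂ (subst (_⊆ _) (filter-all hit? all) (filter⁺ hit? hit? (λ { refl h → h }) Q⊆P))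
    ... | no ¬all = inj₁ (≤-pred (≤-trans (filter-notAll hit? Q (All.¬All⇒Any¬ hit? Q ¬all)) (≤-reflexive len)))

    hits≤length : ∀ {Q j} → length Q ≡ suc j → hits Q ≤ suc j
    hits≤length {Q} len = ≤-trans (length-filter hit? Q) (≤-reflexive len)

    -- The slot sums pass from `w` to `w′`, and `b` preceding singles are replaced by `a`. A marked
    -- single must gain a unit, because it loses a mark.
    Eases : (w w′ : ℕ → ℕ) (a b : ℕ) → Single → Set
    Eases w w′ a b (q , u) = (w′ q + a ≤ w q + b) × (hit u → w′ q + a < w q + b)

    resettle : ∀ {w w′ a b c Ts} → All (Eases w w′ a b) Ts → Settled w g (b + c) Ts → Settled w′ g′ (a + c) Ts
    resettle [] [] = []
    resettle {w} {w′} {a} {b} {c} {(q , u) ∷ Ts} ((le , lt) ∷ es) (p ∷ s) =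
      bnd (hit? u) ∷ subst (λ x → Settled w′ g′ x Ts) (+-suc a c)
                       (resettle es (subst (λ x → Settled w g x Ts) (sym (+-suc b c)) s))
      where
      open ≤-Reasoning
      bnd : Dec (hit u) → w′ q + (a + c) < g′ u
      bnd (no ¬h) = begin-strict
        w′ q + (a + c)  ≡⟨ +-assoc (w′ q) a c ⟨
        w′ q + a + c    ≤⟨ +-monoˡ-≤ c le ⟩
        w q + b + c     ≡⟨ +-assoc (w q) b c ⟩
        w q + (b + c)   <⟨ p ⟩
        g u             ≤⟨ g≤g′ ¬h ⟩
        g′ u            ∎
      bnd (yes h) = ≤-pred (begin-strict
        suc (w′ q + (a + c))  ≡⟨ cong suc (+-assoc (w′ q) a c) ⟨
        suc (w′ q + a) + c    ≤⟨ +-monoˡ-≤ c (lt h) ⟩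
        w q + b + c           ≡⟨ +-assoc (w q) b c ⟩
        w q + (b + c)         <⟨ p ⟩
        g u                   ≤⟨ g≤1+g′ u ⟩
        suc (g′ u)            ∎)

    transfer : ∀ {R R′ a e c s} → R′ + a ≡ R + e → R + (e + c) ≤ s + a → R′ + c ≤ s
    transfer {R} {R′} {a} {e} {c} {s} eq le = +-cancelʳ-≤ a (R′ + c) s (begin
      R′ + c + a    ≡⟨ eq₁ R′ c a ⟩
      R′ + a + c    ≡⟨ cong (_+ c) eq ⟩
      R + e + c     ≡⟨ +-assoc R e c ⟩
      R + (e + c)   ≤⟨ le ⟩
      s + a         ∎)
      where
      open ≤-Reasoning
      eq₁ : ∀ x y z → x + y + z ≡ x + z + y
      eq₁ = solve-∀

    -- Here `a` leaves the bound and `e` enters it; the equation avoids truncated subtraction. As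
    -- `Q` loses at most `hits Q`, richness survives if `e j + hits Q` is paid for by `a j` and the
    -- slack of `∑ g Q` over `R j`.
    keepRich : ∀ (R R′ : ℕ → ℕ) {P} (a e : ℕ → ℕ) → (∀ j → R′ j + a j ≡ R j + e j) →
               (∀ Q j → Q ⊆ P → length Q ≡ suc j → R j + (e j + hits Q) ≤ ∑ g Q + a j) →
               Rich g′ R′ P
    keepRich R R′ a e eq le Q j Q⊆P len =
      +-cancelʳ-≤ (hits Q) _ _ (≤-trans (transfer {R j} {e = e j} (eq j) (le Q j Q⊆P len)) (loss Q))

    -- Equality is stated as `≤`, since richness gives the reverse inequality.
    Tight : List Part → List Single → ℕ → Set
    Tight Ps Ts i = Any (λ P → ∃[ Q ] Q ⊆ marked P × length Q ≡ suc i × ∑ g Q ≤ bound Ps Ts i) Ps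

    tight? : ∀ Ps Ts → Decidable (Tight Ps Ts)
    tight? Ps Ts i =
        Any.any? (λ P → anySublist? (λ Q → (length Q ≟ suc i) ×-dec (∑ g Q ≤? bound Ps Ts i)) (marked P)) Ps

    +-mono-<-≤-suc : ∀ {R s x y} → R < s → x ≤ suc y → R + x ≤ s + y
    +-mono-<-≤-suc {R} {s} {x} {y} R<s x≤1+y =
        ≤-trans (+-monoʳ-≤ R x≤1+y) (≤-trans (≤-reflexive (+-suc R y)) (+-monoˡ-≤ y R<s))

    -- Bob's answers: a whole part, a tight part, a single, a most marked part

    freed : ∀ P Ps q {x} → x ≤ slot (length P) q → rounds Ps q + x ≤ rounds (P ∷ Ps) q + 0
    freed P Ps q {x} x≤ = begin
      rounds Ps q + x                     ≤⟨ +-monoʳ-≤ (rounds Ps q) x≤ ⟩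
      rounds Ps q + slot (length P) q     ≡⟨ +-comm (rounds Ps q) _ ⟩
      rounds (P ∷ Ps) q                   ≡⟨ +-identityʳ _ ⟨
      rounds (P ∷ Ps) q + 0               ∎
      where open ≤-Reasoning

    freed< : ∀ P Ps q {x} → x < slot (length P) q → rounds Ps q + x < rounds (P ∷ Ps) q + 0
    freed< P Ps q {x} x< = subst (_≤ rounds (P ∷ Ps) q + 0) (+-suc (rounds Ps q) x) (freed P Ps q x<)

    -- The demand of `P` at `j` exceeds `j`, so its removal pays for the at most `suc j` marks on
    -- another set; its slot, at least 1, pays for the mark on a single.
    colourPart : ∀ {P Ps Ts} → Safe g (P ∷ Ps) Ts → All hit P → Reply (P ∷ Ps) Ts
    colourPart {P} {Ps} {Ts} s allHit with Safe.allProper s | Safe.rich s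
    ... | prop ∷ props | _ ∷ rich = record
      { legal = allHit
      ; indep = Proper.indep prop
      ; cover = λ { (inj₁ (here v∈)) → inj₁ v∈ ; (inj₁ (there v∈)) → inj₂ (inj₁ v∈) ; (inj₂ v∈) → inj₂ (inj₂ v∈) }
      ; safe = record
        { allProper = props
        ; rich = All.map (λ r → keepRich (bound (P ∷ Ps) Ts) (bound Ps Ts) (demand (length P)) (λ _ → 0)
                   (λ j → eq (demand (length P) j) (∑ (λ P → demand (length P) j) Ps) (∑ (λ t → j ⊓ level t) Ts))
                   (λ Q j Q⊆P len → +-mono-≤ (r Q j Q⊆P len) (≤-trans (hits≤length {Q} len) (j<demand (length P) j)))) rich
        ; settled = resettle {a = 0} {b = 0}
            (All.universal (λ (q , u) → freed P Ps q z≤n , λ _ → freed< P Ps q (1≤slot (length P) q)) Ts)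
            (Safe.settled s)
        ; descending = Safe.descending s }
      ; shrink = +-monoˡ-< (length Ts) (m<n+m _ (≤-trans z<s (Proper.large prop))) }
      where
      eq : ∀ d a t → (a + t) + d ≡ ((d + a) + t) + 0
      eq = solve-∀

    colourTight : ∀ {P Ps Ts i Q} → Safe g (P ∷ Ps) Ts → Q ⊆ marked P → length Q ≡ suc i →
                  ∑ g Q ≤ bound (P ∷ Ps) Ts i → (∀ {j} → i < j → ¬ Tight (P ∷ Ps) Ts j) →
                  Reply (P ∷ Ps) Ts
    colourTight {P} {Ps} {Ts} {i} {Q} s Q⊆M len tight top with Safe.allProper s | Safe.rich s
    ... | prop ∷ props | richP ∷ rich = go (splitAt q q≤N (Safe.descending s)) s tight top richP rich
      where
      open ≤-Reasoning
      q = suc i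
      rest = unmarked P
      d = length rest
      r = length P
      q≤hits : q ≤ hits P
      q≤hits = subst (_≤ hits P) len (length-mono-≤ Q⊆M)
      d+q≤r : d + q ≤ r
      d+q≤r = ≤-trans (+-monoʳ-≤ d q≤hits) (≤-reflexive (length-filter-¬ hit? P))
      d<r : d < r
      d<r = ≤-trans (m<m+n d z<s) d+q≤r
      q≤N : q ≤ N
      q≤N = ≤-trans (m+n≤o⇒n≤o d d+q≤r) (Proper.small prop)
      go : ∀ {Ts} → Split N q Ts → Safe g (P ∷ Ps) Ts → ∑ g Q ≤ bound (P ∷ Ps) Ts i →
           (∀ {j} → i < j → ¬ Tight (P ∷ Ps) Ts j) →
           Rich g (bound (P ∷ Ps) Ts) P → All (Rich g (bound (P ∷ Ps) Ts)) Ps → Reply (P ∷ Ps) Ts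
      go record { hi = hi ; lo = lo ; split = refl ; hi≥ = hi≥ ; lo< = lo< ; inserted = inserted } s tight top richP rich = record
        { legal = All.all-filter hit? P
        ; indep = filter-indep hit? (Proper.indep prop)
        ; cover = cover
        ; safe = record
          { allProper = props
          ; rich = All.tabulate λ P₀∈ → keepRich R R′ (demand r) (λ j → d * (j ⊓ q)) drop (survives P₀∈)
          ; settled = settled′
          ; descending = inserted rest }
        ; shrink = shrink }
        where
        new = label q rest
        R  = bound (P ∷ Ps) (hi ++ lo)
        R′ = bound Ps (hi ++ new ++ lo)
        cover : ∀ {v} → Covered v (P ∷ Ps) (hi ++ lo) → v ∈ marked P ⊎ Covered v Ps (hi ++ new ++ lo)
        cover {v} (inj₁ (here v∈)) with hit? v
        ... | yes h = inj₁ (∈-filter⁺ hit? v∈ h)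
        ... | no ¬h = inj₂ (inj₂ (Any.++⁺ʳ hi (Any.++⁺ˡ (Any.map⁺ (∈-filter⁺ (¬? ∘ hit?) v∈ ¬h)))))
        cover (inj₁ (there v∈)) = inj₂ (inj₁ v∈)
        cover (inj₂ v∈) with Any.++⁻ hi v∈
        ... | inj₁ v∈hi = inj₂ (inj₂ (Any.++⁺ˡ v∈hi))
        ... | inj₂ v∈lo = inj₂ (inj₂ (Any.++⁺ʳ hi (Any.++⁺ʳ new v∈lo)))
        drop : ∀ j → R′ j + demand r j ≡ R j + d * (j ⊓ q)
        drop j = trans (cong (λ x → (D + x) + demand r j) sum-new)
            (trans (eq D (demand r j) (T hi) (T lo) (d * (j ⊓ q)))
                   (cong (λ x → ((demand r j + D) + x) + d * (j ⊓ q)) (sym (∑-++ _ hi lo))))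
          where
          D = ∑ (λ P → demand (length P) j) Ps
          T : List Single → ℕ
          T = ∑ (λ t → j ⊓ level t)
          sum-new : T (hi ++ new ++ lo) ≡ T hi + (d * (j ⊓ q) + T lo)
          sum-new = trans (∑-++ _ hi (new ++ lo)) (cong (T hi +_) (trans (∑-++ _ new lo) (cong (_+ T lo)
            (trans (∑-const {xs = new} (All.map⁺ (All.universal (λ _ → refl) rest)))
                (cong (_* (j ⊓ q)) (length-label q rest))))))
          eq : ∀ a b h l x → (a + (h + (x + l))) + b ≡ ((b + a) + (h + l)) + x
          eq = solve-∀
        survives : ∀ {P₀} → P₀ ∈ Ps → ∀ Q₀ j → Q₀ ⊆ P₀ → length Q₀ ≡ suc j →
                   R j + (d * (j ⊓ q) + hits Q₀) ≤ ∑ g Q₀ + demand r j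
        survives {P₀} P₀∈ Q₀ j Q₀⊆P₀ len₀ with j ≤? i
        -- Up to the tight index the slots are large enough to pay even if all `suc j` vertices are
        -- marked.
        ... | yes j≤i = +-mono-≤ (All.lookup rich P₀∈ Q₀ j Q₀⊆P₀ len₀) (≤-trans
                (+-mono-≤ (*-monoʳ-≤ d (m⊓n≤m j q)) (hits≤length {Q₀} len₀)) (demand-below j (s≤s j≤i) d+q≤r))
        ... | no j≰i with hits-or-all Q₀⊆P₀ len₀
        ...   | inj₁ few = +-mono-≤ (All.lookup rich P₀∈ Q₀ j Q₀⊆P₀ len₀) (≤-trans
                (+-mono-≤ (*-monoʳ-≤ d (m⊓n≤n j q)) few) (demand-above j (≰⇒> j≰i) d+q≤r))
        -- By maximality of `i` this fully marked set is not tight, which gives the one unit by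
        -- which `demand-above` falls short.
        ...   | inj₂ Q₀⊆M = +-mono-<-≤-suc
            (≰⇒> λ le → top (≰⇒> j≰i) (there (lose P₀∈ (Q₀ , Q₀⊆M , len₀ , le))))
            (≤-trans
                (+-mono-≤ (*-monoʳ-≤ d (m⊓n≤n j q)) (hits≤length {Q₀} len₀))
                    (≤-trans (≤-reflexive (+-suc (d * q) j)) (s≤s (demand-above j (≰⇒> j≰i) d+q≤r))))
        rest-rich : All (λ u → rounds (P ∷ Ps) q + length hi ≤ g′ u) rest
        rest-rich = All.tabulate λ u∈ → let u∈P , ¬h = ∈-filter⁻ (¬? ∘ hit?) u∈ in ≤-trans (wealthy u∈P ¬h) (g≤g′ ¬h)
          where
          wealthy : ∀ {u} → u ∈ P → ¬ hit u → rounds (P ∷ Ps) q + length hi ≤ g u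
          wealthy {u} u∈P ¬h with extend g (⊆-trans Q⊆M (filter-⊆ hit? P)) u∈P
              (λ u∈Q → ¬h (proj₂ (∈-filter⁻ hit? {xs = P} (Sublist.lookup Q⊆M u∈Q))))
          -- The total of `Q⁺` is at least `R (suc i)` and that of `Q` at most `R i`, so `g u` alone
          -- makes up the increase in `bound-suc`.
          ... | Q⁺ , Q⁺⊆P , len⁺ , eq = +-cancelˡ-≤ (R i) _ _ (begin
            R i + (rounds (P ∷ Ps) q + length hi)  ≤⟨ bound-suc (P ∷ Ps) i hi≥ ⟩
            R (suc i)                              ≤⟨ richP Q⁺ (suc i) Q⁺⊆P (trans len⁺ (cong suc len)) ⟩
            ∑ g Q⁺                                 ≡⟨ eq ⟩
            ∑ g Q + g u                            ≤⟨ +-monoˡ-≤ (g u) tight ⟩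
            R i + g u                              ∎)
        -- The slot that `P` gives up at level `q` is at least `d`, room for the `d` new singles one
        -- behind the other.
        fits : rounds Ps q + ((length hi + 0) + length rest) ≤ rounds (P ∷ Ps) q + length hi
        fits = ≤-trans (≤-reflexive (eq (rounds Ps q) (length hi) d))
            (+-monoˡ-≤ (length hi) (+-monoˡ-≤ (rounds Ps q) (slot-≥ d+q≤r)))
          where
          eq : ∀ w h d → w + ((h + 0) + d) ≡ (d + w) + h
          eq = solve-∀
        settled′ : Settled (rounds Ps) g′ 0 (hi ++ new ++ lo)
        settled′ with Settled-++⁻ hi (Safe.settled s)
        ... | sHi , sLo = Settled-++⁺ hi
          (resettle {a = 0} {b = 0}
              (All.universal (λ (l , _) → freed P Ps l z≤n , λ _ → freed< P Ps l (1≤slot r l)) hi) sHi)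
          (Settled-++⁺ new (Settled-const rest (length hi + 0) rest-rich fits)
            (resettle {a = length new} {b = 0}
                (All.map (λ {t} l<q → let lt = late l<q in freed P Ps (level t) (<⇒≤ lt) ,
                λ _ → freed< P Ps (level t) lt) lo<) sLo))
          where
          -- A single of lower level now waits behind `d` more singles; the slot freed by `P` covers
          -- these and one mark.
          late : ∀ {l} → l < q → length new < slot r l
          late {l} l<q = slot-≥ {suc (length new)} {l} (begin
            suc (length new) + l  ≡⟨ cong (λ x → suc x + l) (length-label q rest) ⟩
            suc d + l             ≡⟨ +-suc d l ⟨
            d + suc l             ≤⟨ +-monoʳ-≤ d l<q ⟩
            d + q                 ≤⟨ d+q≤r ⟩
            r                     ∎)
        shrink : size Ps (hi ++ new ++ lo) < size (P ∷ Ps) (hi ++ lo)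
        shrink = begin-strict
          S + length (hi ++ new ++ lo)
              ≡⟨ cong (S +_) (trans (length-++ hi)
              (cong (length hi +_) (trans (length-++ new) (cong (_+ length lo) (length-label q rest))))) ⟩
          S + (length hi + (d + length lo))        ≡⟨ eq S (length hi) d (length lo) ⟩
          d + (S + (length hi + length lo))        <⟨ +-monoˡ-< _ d<r ⟩
          r + (S + (length hi + length lo))        ≡⟨ +-assoc r S _ ⟨
          (r + S) + (length hi + length lo)        ≡⟨ cong (r + S +_) (length-++ hi) ⟨
          (r + S) + length (hi ++ lo)              ∎
          where
          S = ∑ length Ps
          eq : ∀ s h d l → s + (h + (d + l)) ≡ d + (s + (h + l))
          eq = solve-∀

    -- Removing the single lowers the bound by `j ⊓ q`. This pays for the hits of any set: they are
    -- at most `q` by `few`, and at most `j` unless the set is fully marked and so has a spare unit.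
    -- Singles in `pre` are unmarked; those in `post` have one fewer before them.
    colourSingle : ∀ {Ps q u} pre {post} → Safe g Ps (pre ++ (q , u) ∷ post) →
                   All (¬_ ∘ hit ∘ proj₂) pre → hit u → Descending N (pre ++ post) →
                   All (λ P → hits P ≤ q) Ps → (∀ {j} → ¬ Tight Ps (pre ++ (q , u) ∷ post) j) →
                   Reply Ps (pre ++ (q , u) ∷ post)
    colourSingle {Ps} {q} {u} pre {post} s pre¬ hitu desc few untight = record
      { chosen = u ∷ []
      ; legal = hitu ∷ []
      ; indep = λ { (here refl) (here refl) → irrefl }
      ; cover = cover
      ; safe = record
        { allProper = Safe.allProper s
        ; rich = All.tabulate λ P∈ → keepRich R (bound Ps (pre ++ post)) (_⊓ q) (λ _ → 0) drop (survives P∈)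
        ; settled = settled′
        ; descending = desc }
      ; shrink = +-monoʳ-< (∑ length Ps) (begin-strict
          length (pre ++ post)               ≡⟨ length-++ pre ⟩
          length pre + length post           <⟨ +-monoʳ-< (length pre) ≤-refl ⟩
          length pre + suc (length post)     ≡⟨ length-++ pre ⟨
          length (pre ++ (q , u) ∷ post)     ∎) }
      where
      open ≤-Reasoning
      R = bound Ps (pre ++ (q , u) ∷ post)
      cover : ∀ {v} → Covered v Ps (pre ++ (q , u) ∷ post) → v ∈ u ∷ [] ⊎ Covered v Ps (pre ++ post)
      cover (inj₁ v∈) = inj₂ (inj₁ v∈)
      cover (inj₂ v∈) with Any.++⁻ pre v∈
      ... | inj₁ v∈pre          = inj₂ (inj₂ (Any.++⁺ˡ v∈pre))
      ... | inj₂ (here refl)    = inj₁ (here refl)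
      ... | inj₂ (there v∈post) = inj₂ (inj₂ (Any.++⁺ʳ pre v∈post))
      drop : ∀ j → bound Ps (pre ++ post) j + j ⊓ q ≡ R j + 0
      drop j = trans (cong (λ x → (D + x) + j ⊓ q) (∑-++ _ pre post))
                 (trans (eq D (T pre) (T post) (j ⊓ q)) (cong (λ x → (D + x) + 0) (sym (∑-++ _ pre ((q , u) ∷ post)))))
        where
        D = ∑ (λ P → demand (length P) j) Ps
        T : List Single → ℕ
        T = ∑ (λ t → j ⊓ level t)
        eq : ∀ a p t x → (a + (p + t)) + x ≡ (a + (p + (x + t))) + 0
        eq = solve-∀
      survives : ∀ {P} → P ∈ Ps → ∀ Q j → Q ⊆ P → length Q ≡ suc j → R j + (0 + hits Q) ≤ ∑ g Q + j ⊓ q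
      survives {P} P∈ Q j Q⊆P len with hits-or-all Q⊆P len
      ... | inj₁ hits≤j = +-mono-≤ (All.lookup (Safe.rich s) P∈ Q j Q⊆P len)
          (⊓-glb hits≤j (≤-trans (hits-mono Q⊆P) (All.lookup few P∈)))
      ... | inj₂ Q⊆M    = +-mono-<-≤-suc (≰⇒> λ le → untight (lose P∈ (Q , Q⊆M , len , le)))
                            (⊓-glb (hits≤length {Q} len) (m≤n⇒m≤1+n (≤-trans (hits-mono Q⊆P) (All.lookup few P∈))))
      settled′ : Settled (rounds Ps) g′ 0 (pre ++ post)
      settled′ with Settled-++⁻ pre (Safe.settled s)
      ... | sPre , _ ∷ sPost = Settled-++⁺ pre
        (resettle {a = 0} {b = 0} (All.map (λ ¬h → ≤-refl , λ h → contradiction h ¬h) pre¬) sPre)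
        (resettle {a = 0} {b = 1}
            (All.universal (λ (l , _) → +-monoʳ-≤ (rounds Ps l) z≤n , λ _ → +-monoʳ-< (rounds Ps l) z<s) post) sPost)

    -- Levels decrease along the list, so the first marked single has the highest level of all
    -- marked ones; this is `top`.
    record FirstMarked (b : ℕ) (Ts : List Single) : Set where
      field
        {pre post} : List Single
        {q}        : ℕ
        {u}        : A
        split      : Ts ≡ pre ++ (q , u) ∷ post
        pre¬       : All (¬_ ∘ hit ∘ proj₂) pre
        hitu       : hit u
        removed    : Descending b (pre ++ post)
        top        : All (λ t → hit (proj₂ t) → level t ≤ q) Ts

    firstMarked : ∀ {b Ts} → Descending b Ts → All (¬_ ∘ hit ∘ proj₂) Ts ⊎ FirstMarked b Ts
    firstMarked [] = inj₁ []
    firstMarked {Ts = (q , u) ∷ Ts} (q≤b ∷ d) with hit? u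
    ... | yes h = inj₂ (record { pre = [] ; split = refl ; pre¬ = [] ; hitu = h ; removed = Descending-weaken q≤b d
                               ; top = (λ _ → ≤-refl) ∷ All.map (λ le _ → le) (Descending⇒All d) })
    ... | no ¬h with firstMarked d
    ...   | inj₁ none = inj₁ (¬h ∷ none)
    ...   | inj₂ record { split = split ; pre¬ = pre¬ ; hitu = hitu ; removed = removed ; top = top } =
      inj₂ (record { split = cong ((q , u) ∷_) split ; pre¬ = ¬h ∷ pre¬ ; hitu = hitu
                   ; removed = q≤b ∷ removed ; top = (λ h → contradiction h ¬h) ∷ top })

    module _ {P Ps Ts q} (s : Safe g (P ∷ Ps) Ts)
             (singles≤q : All (λ t → hit (proj₂ t) → level t ≤ q) Ts)
             (q<hits : q < hits P) (most : All (λ P₀ → hits P₀ ≤ hits P) Ps)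
             (untight : ∀ {j} → ¬ Tight (P ∷ Ps) Ts j) where

      private
        R = bound (P ∷ Ps) Ts
        d = length (unmarked P)
        r = length P

        d+hits≤r : d + hits P ≤ r
        d+hits≤r = ≤-reflexive (length-filter-¬ hit? P)

        -- Here `e` is what the remainder of `P` adds to the bound. At index 0 the bound need not
        -- drop, and a marked vertex is paid for by not being tight. At higher indices the drop
        -- covers `hits P`, the largest number of hits in any part.
        survives : ∀ (e : ℕ → ℕ) → e 0 ≤ 1 → (∀ j → e (suc j) + hits P ≤ demand r (suc j)) →
                   ∀ {P₀} → P₀ ∈ Ps → ∀ Q j → Q ⊆ P₀ → length Q ≡ suc j → R j + (e j + hits Q) ≤ ∑ g Q + demand r j
        survives e e₀≤1 _ {P₀} P₀∈ Q zero Q⊆P₀ len with hits-or-all Q⊆P₀ len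
        ... | inj₁ none = +-mono-≤ (All.lookup (Safe.rich s) (there P₀∈) Q 0 Q⊆P₀ len) (+-mono-≤ e₀≤1 none)
        ... | inj₂ Q⊆M  = +-mono-<-≤-suc (≰⇒> λ le → untight (there (lose P₀∈ (Q , Q⊆M , len , le))))
            (+-mono-≤ e₀≤1 (hits≤length {Q} len))
        survives e _ e≤ {P₀} P₀∈ Q (suc j) Q⊆P₀ len =
          +-mono-≤ (All.lookup (Safe.rich s) (there P₀∈) Q (suc j) Q⊆P₀ len)
                   (≤-trans (+-monoʳ-≤ (e (suc j)) (≤-trans (hits-mono Q⊆P₀) (All.lookup most P₀∈))) (e≤ j))

      shrinkPart : 2 ≤ length (unmarked P) → Reply (P ∷ Ps) Ts
      shrinkPart 2≤d with Safe.allProper s | Safe.rich s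
      ... | prop ∷ props | richP ∷ _ = record
        { legal = All.all-filter hit? P
        ; indep = filter-indep hit? (Proper.indep prop)
        ; cover = cover
        ; safe = record
          { allProper = proper 2≤d (≤-trans (length-filter (¬? ∘ hit?) P) (Proper.small prop))
                          (filter-indep (¬? ∘ hit?) (Proper.indep prop))
                        ∷ props
          ; rich = keepRich R (bound (unmarked P ∷ Ps) Ts) (demand r) (demand d) drop own
                   ∷ All.tabulate λ P₀∈ → keepRich R (bound (unmarked P ∷ Ps) Ts) (demand r) (demand d) drop
                       (survives (demand d) ≤-refl (λ j → demand-gap j 2≤d d+hits≤r) P₀∈)
          ; settled = resettle {a = 0} {b = 0} (All.map eases singles≤q) (Safe.settled s)
          ; descending = Safe.descending s }
        ; shrink = +-monoˡ-< (length Ts) (+-monoˡ-< (∑ length Ps) (≤-trans (m<m+n d (≤-trans z<s q<hits)) d+hits≤r)) }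
        where
        eases : ∀ {t} → (hit (proj₂ t) → level t ≤ q) → Eases (rounds (P ∷ Ps)) (rounds (unmarked P ∷ Ps)) 0 0 t
        eases {l , _} le =
          +-monoˡ-≤ 0 (+-monoˡ-≤ (rounds Ps l) (slot-mono l (m+n≤o⇒m≤o d d+hits≤r))) ,
          λ h → +-monoˡ-< 0 (+-monoˡ-< (rounds Ps l) (slot-gap (≤-trans z<s 2≤d) d+hits≤r (≤-<-trans (le h) q<hits)))
        cover : ∀ {v} → Covered v (P ∷ Ps) Ts → v ∈ marked P ⊎ Covered v (unmarked P ∷ Ps) Ts
        cover {v} (inj₁ (here v∈)) with hit? v
        ... | yes h = inj₁ (∈-filter⁺ hit? v∈ h)
        ... | no ¬h = inj₂ (inj₁ (here (∈-filter⁺ (¬? ∘ hit?) v∈ ¬h)))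
        cover (inj₁ (there v∈)) = inj₂ (inj₁ (there v∈))
        cover (inj₂ v∈)         = inj₂ (inj₂ v∈)
        drop : ∀ j → bound (unmarked P ∷ Ps) Ts j + demand r j ≡ R j + demand d j
        drop j = eq (demand d j) (demand r j) _ _
          where
          eq : ∀ a b x t → ((a + x) + t) + b ≡ ((b + x) + t) + a
          eq = solve-∀
        -- Sets of unmarked vertices lose nothing, so it suffices that the demand does not grow.
        own : ∀ Q j → Q ⊆ unmarked P → length Q ≡ suc j → R j + (demand d j + hits Q) ≤ ∑ g Q + demand r j
        own Q j Q⊆ len = +-mono-≤ (richP Q j (⊆-trans Q⊆ (filter-⊆ (¬? ∘ hit?) P)) len)
          (≤-trans (≤-reflexive (trans (cong (λ x → demand d j + length x)
              (filter-none hit? (All-resp-⊆ Q⊆ (All.all-filter (¬? ∘ hit?) P))))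
              (+-identityʳ _)))
                   (demand-mono j (m+n≤o⇒m≤o d d+hits≤r)))

      leaveSingle : ∀ {u} → unmarked P ≡ u ∷ [] → Reply (P ∷ Ps) Ts
      leaveSingle {u} rest with Safe.allProper s | Safe.rich s
      ... | prop ∷ props | richP ∷ _ = record
        { legal = All.all-filter hit? P
        ; indep = filter-indep hit? (Proper.indep prop)
        ; cover = cover
        ; safe = record
          { allProper = props
          ; rich = All.tabulate λ P₀∈ → keepRich R (bound Ps ((N , u) ∷ Ts)) (demand r) (_⊓ N) drop
                     (survives (_⊓ N) z≤n
                         (λ j → ≤-trans (+-monoˡ-≤ (hits P) (m⊓n≤m (suc j) N)) (demand-last j hits<r)) P₀∈)
          -- Every other single now has one more before it. The slot freed by `P` is at least 1, and
          -- at least 2 for a marked single, whose level is below `hits P` and so at most `r − 2`.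
          ; settled = fits ∷ resettle {a = 1} {b = 0} (All.map (λ {t} le → freed P Ps (level t) (1≤slot r (level t))
                                                         , λ h → freed< P Ps (level t) (slot>1 (≤-<-trans (le h) q<hits)))
                                        singles≤q) (Safe.settled s)
          ; descending = ≤-refl ∷ Safe.descending s }
        ; shrink = shrink }
        where
        open ≤-Reasoning
        hits<r : suc (hits P) ≤ r
        hits<r = subst (λ x → length x + hits P ≤ r) rest d+hits≤r
        slot>1 : ∀ {l} → l < hits P → 1 < slot r l
        slot>1 {l} l<hits = ≤-<-trans (1≤slot 1 l) (slot-gap ≤-refl hits<r l<hits)
        cover : ∀ {v} → Covered v (P ∷ Ps) Ts → v ∈ marked P ⊎ Covered v Ps ((N , u) ∷ Ts)
        cover {v} (inj₁ (here v∈)) with hit? v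
        ... | yes h = inj₁ (∈-filter⁺ hit? v∈ h)
        ... | no ¬h with subst (v ∈_) rest (∈-filter⁺ (¬? ∘ hit?) v∈ ¬h)
        ...   | here refl = inj₂ (inj₂ (here refl))
        cover (inj₁ (there v∈)) = inj₂ (inj₁ v∈)
        cover (inj₂ v∈)         = inj₂ (inj₂ (there v∈))
        drop : ∀ j → bound Ps ((N , u) ∷ Ts) j + demand r j ≡ R j + j ⊓ N
        drop j = eq (demand r j) _ _ (j ⊓ N)
          where
          eq : ∀ b x t n → (x + (n + t)) + b ≡ ((b + x) + t) + n
          eq = solve-∀
        ¬hitu : ¬ hit u
        ¬hitu = proj₂ (∈-filter⁻ (¬? ∘ hit?) {xs = P} (subst (u ∈_) (sym rest) (here refl)))
        -- Richness of the one-vertex set at index 0 makes `g u` at least the number of parts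
        -- including `P`, while at level `N` each other part has slot 1.
        fits : rounds Ps N + 0 < g′ u
        fits = begin-strict
          rounds Ps N + 0                ≡⟨ +-identityʳ _ ⟩
          rounds Ps N                    ≡⟨ rounds-N props ⟩
          length Ps * 1                  ≡⟨ ∑-const (All.universal (λ _ → refl) Ps) ⟨
          ∑ (λ P → demand (length P) 0) Ps  <⟨ m≤m+n _ _ ⟩
          R 0                            ≤⟨ richP (u ∷ []) 0 (subst (_⊆ P) rest (filter-⊆ (¬? ∘ hit?) P)) refl ⟩
          g u + 0                        ≡⟨ +-identityʳ (g u) ⟩
          g u                            ≤⟨ g≤g′ ¬hitu ⟩
          g′ u                           ∎
        shrink : ∑ length Ps + suc (length Ts) < (r + ∑ length Ps) + length Ts
        shrink = begin-strict
          ∑ length Ps + suc (length Ts)    ≡⟨ +-suc _ _ ⟩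
          1 + (∑ length Ps + length Ts)    <⟨ +-monoˡ-< _ (Proper.large prop) ⟩
          r + (∑ length Ps + length Ts)    ≡⟨ +-assoc r _ _ ⟨
          (r + ∑ length Ps) + length Ts    ∎

      colourLargest : Reply (P ∷ Ps) Ts
      colourLargest with unmarked P in rest
      ... | []          = colourPart s (All.tabulate λ {v} v∈ → decidable-stable (hit? v) λ ¬h →
                            contradiction (subst (v ∈_) rest (∈-filter⁺ (¬? ∘ hit?) v∈ ¬h)) λ ())
      ... | _ ∷ []      = leaveSingle rest
      ... | _ ∷ _ ∷ _   = shrinkPart (subst (λ x → 2 ≤ length x) (sym rest) (s≤s (s≤s z≤n)))

    -- Choosing the answer

    Tight-↭ : ∀ {Ps Ps′ Ts j} → Ps ↭ Ps′ → Tight Ps Ts j → Tight Ps′ Ts j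
    Tight-↭ {Ts = Ts} {j} p t =
        Any.map (λ (Q , Q⊆ , len , le) → Q , Q⊆ , len , ≤-trans le (≤-reflexive (bound-↭ {Ts = Ts} p j)))
        (Any-resp-↭ p t)

    colourMost : ∀ {Ps Ts q} → Safe g Ps Ts → All (λ t → hit (proj₂ t) → level t ≤ q) Ts →
                 Any (λ P → q < hits P) Ps → (∀ {j} → ¬ Tight Ps Ts j) → Reply Ps Ts
    colourMost {Ts = Ts} s singles≤q some untight with find some
    ... | P₀ , P₀∈ , q<hits with maximum hits P₀∈
    ...   | P , P∈ , most with pick P∈
    ...     | Ps′ , p = Reply-↭ p (colourLargest (Safe-↭ p s) singles≤q (≤-trans q<hits (All.lookup most P₀∈))
                          (All.tail (All-resp-↭ p most)) (untight ∘ Tight-↭ {Ts = Ts} (↭-sym p)))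

    reply : ∀ {Ps Ts v} → Safe g Ps Ts → hit v → Covered v Ps Ts → Reply Ps Ts
    reply {Ps} {Ts} s hitv v∈ with greatest (tight? Ps Ts) N none
      where
      -- A set of size `suc j` within one part forces `j < N`, so the search for the greatest tight
      -- index can start below `N`.
      none : ∀ {j} → N ≤ j → ¬ Tight Ps Ts j
      none {j} N≤j t with find t
      ... | P , P∈ , Q , Q⊆M , len , _ = <-irrefl refl (begin-strict
        j                    <⟨ ≤-reflexive (sym len) ⟩
        length Q             ≤⟨ length-mono-≤ Q⊆M ⟩
        length (marked P)    ≤⟨ length-filter hit? P ⟩
        length P             ≤⟨ Proper.small (All.lookup (Safe.allProper s) P∈) ⟩
        N                    ≤⟨ N≤j ⟩
        j                    ∎)
        where open ≤-Reasoning
    ... | inj₁ (i , tight , top) with find tight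
    ...   | P , P∈ , Q , Q⊆M , len , le with pick P∈
    ...     | Ps′ , p = Reply-↭ p (colourTight (Safe-↭ p s) Q⊆M len (≤-trans le (≤-reflexive (bound-↭ {Ts = Ts} p i)))
                          (λ i<j → top i<j ∘ Tight-↭ {Ts = Ts} (↭-sym p)))
    reply {Ps} {Ts} s hitv v∈ | inj₂ untight with firstMarked (Safe.descending s)
    ... | inj₁ none = colourMost s (All.map (λ ¬h h → contradiction h ¬h) none) (some v∈) untight
      where
      some : ∀ {Ps} → Covered _ Ps Ts → Any (λ P → 0 < hits P) Ps
      some (inj₁ v∈) = Any.map (λ v∈P → ∈-length (∈-filter⁺ hit? v∈P hitv)) v∈
      some (inj₂ v∈) with find v∈
      ... | _ , t∈ , refl = contradiction hitv (All.lookup none t∈)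
    ... | inj₂ record { pre = pre ; q = q ; split = refl ; pre¬ = pre¬ ; hitu = hitu ; removed = removed ; top = top }
        with Any.any? (λ P → q <? hits P) Ps
    ...   | yes some = colourMost s top some untight
    ...   | no ¬some = colourSingle pre s pre¬ hitu removed (All.map ≮⇒≥ (All.¬Any⇒All¬ Ps ¬some)) untight

-- Counting with lists, subsets and sizes

∈-tabulate⁺ : ∀ {n} {P : Pred (Fin n) 0ℓ} (P? : Decidable P) {v} → P v → v Subset.∈ Vec.tabulate (does ∘ P?)
∈-tabulate⁺ P? {v} p = lookup⇒[]= v _ (trans (lookup∘tabulate (does ∘ P?) v) (dec-true (P? v) p))

∈-tabulate⁻ : ∀ {n} {P : Pred (Fin n) 0ℓ} (P? : Decidable P) {v} → v Subset.∈ Vec.tabulate (does ∘ P?) → P v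
∈-tabulate⁻ P? {v} v∈ with P? v in eq
... | yes p = p
... | no _  = contradiction (trans (sym ([]=⇒lookup v∈)) (trans (lookup∘tabulate (does ∘ P?) v) (cong does eq))) λ ()

x∈p─q⇒x∉q : ∀ {n} {p q : Subset n} {x} → x Subset.∈ p ─ q → ¬ x Subset.∈ q
x∈p─q⇒x∉q {p = _ ∷ p} {q = outside ∷ q} here       ()
x∈p─q⇒x∉q {p = _ ∷ p} {q = _ ∷ q}       (there x∈) (there x∈q) = x∈p─q⇒x∉q x∈ x∈q

length-filter-tabulate : ∀ {n} {B : Set} {P : Pred B 0ℓ} (P? : Decidable P) (f : Fin n → B) →
                         length (filter P? (List.tabulate f)) ≡ ∣ Vec.tabulate (does ∘ P? ∘ f) ∣
length-filter-tabulate {zero}  P? f = refl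
length-filter-tabulate {suc n} P? f with does (P? (f zero))
... | true  = cong suc (length-filter-tabulate P? (f ∘ suc))
... | false = length-filter-tabulate P? (f ∘ suc)

length-filter-map : ∀ {B C : Set} {P : Pred B 0ℓ} {Q : Pred C 0ℓ} (P? : Decidable P) (Q? : Decidable Q)
                    (f : B → C) → (∀ {x} → P x → Q (f x)) → ∀ xs →
                    length (filter P? xs) ≤ length (filter Q? (map f xs))
length-filter-map P? Q? f P⇒Q [] = z≤n
length-filter-map P? Q? f P⇒Q (x ∷ xs) with P? x | Q? (f x)
... | yes _ | yes _ = s≤s (length-filter-map P? Q? f P⇒Q xs)
... | no _  | yes _ = m≤n⇒m≤1+n (length-filter-map P? Q? f P⇒Q xs)
... | no _  | no _  = length-filter-map P? Q? f P⇒Q xs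
... | yes p | no ¬q = contradiction (P⇒Q p) ¬q

∑-filter : ∀ {B : Set} {P : Pred B 0ℓ} (P? : Decidable P) (f : B → ℕ) xs → ∑ f (filter P? xs) ≤ ∑ f xs
∑-filter P? f [] = z≤n
∑-filter P? f (x ∷ xs) with does (P? x)
... | true  = +-monoʳ-≤ (f x) (∑-filter P? f xs)
... | false = m≤n⇒m≤o+n (f x) (∑-filter P? f xs)

length-concat : ∀ {B : Set} {xss : List (List B)} → All (λ xs → length xs ≤ 1) xss → length (concat xss) ≤ length xss
length-concat []                  = z≤n
length-concat (_∷_ {x = xs} le les) = ≤-trans (≤-reflexive (length-++ xs)) (+-mono-≤ le (length-concat les))

∑ᶠ-mono : ∀ {n} {f h : Fin n → ℕ} → (∀ i → f i ≤ h i) → ∑ᶠ f ≤ ∑ᶠ h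
∑ᶠ-mono {zero}  f≤h = z≤n
∑ᶠ-mono {suc n} f≤h = +-mono-≤ (f≤h zero) (∑ᶠ-mono (f≤h ∘ suc))

∑ᶠ-mono-at : ∀ {n d} {f h : Fin n → ℕ} i → (∀ i → f i ≤ h i) → d + f i ≤ h i → d + ∑ᶠ f ≤ ∑ᶠ h
∑ᶠ-mono-at {d = d} {f} zero f≤h at =
  ≤-trans (≤-reflexive (sym (+-assoc d (f zero) _))) (+-mono-≤ at (∑ᶠ-mono (f≤h ∘ suc)))
∑ᶠ-mono-at {d = d} {f} (suc i) f≤h at =
  ≤-trans (≤-reflexive (eq d (f zero) _)) (+-mono-≤ (f≤h zero) (∑ᶠ-mono-at {d = d} i (f≤h ∘ suc) at))
  where
  eq : ∀ a b c → a + (b + c) ≡ b + (a + c)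
  eq = solve-∀

-- Grouping by size: size `p + 2` is counted at index `p`, while sizes 0 and 1 contribute
-- `triangle 0`, which is 0.
∑-bySize : ∀ {B : Set} (s : B → ℕ) m xs → All (λ x → s x ≤ m) xs →
           ∑ (λ x → triangle (s x ∸ 1)) xs ≤
           ∑ᶠ {m ∸ 1} (λ i → triangle (suc (toℕ i)) * length (filter (λ x → s x ≟ 2 + toℕ i) xs))
∑-bySize s m [] [] = z≤n
∑-bySize s m (x ∷ xs) (sx≤m ∷ le) = step (s x) refl
  where
  count : List _ → ℕ → ℕ
  count ys p = length (filter (λ x → s x ≟ p) ys)
  count-∷ : ∀ p → count xs p ≤ count (x ∷ xs) p
  count-∷ p with does (s x ≟ p)
  ... | true  = n≤1+n _
  ... | false = ≤-refl
  total : List _ → ℕ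
  total ys = ∑ᶠ {m ∸ 1} (λ i → triangle (suc (toℕ i)) * count ys (2 + toℕ i))
  rest : ∑ (λ x → triangle (s x ∸ 1)) xs ≤ total (x ∷ xs)
  rest = ≤-trans (∑-bySize s m xs le) (∑ᶠ-mono {m ∸ 1} λ i → *-monoʳ-≤ (triangle (suc (toℕ i))) (count-∷ (2 + toℕ i)))
  step : ∀ p → s x ≡ p → triangle (p ∸ 1) + ∑ (λ x → triangle (s x ∸ 1)) xs ≤ total (x ∷ xs)
  step 0 _ = rest
  step 1 _ = rest
  step (suc (suc p)) eq = ≤-trans (+-monoʳ-≤ (triangle (suc p)) (∑-bySize s m xs le))
    (∑ᶠ-mono-at {m ∸ 1} {triangle (suc p)} i (λ i → *-monoʳ-≤ (triangle (suc (toℕ i))) (count-∷ (2 + toℕ i))) at)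
    where
    p<m-1 : p < m ∸ 1
    p<m-1 = ∸-monoˡ-≤ 1 (subst (_≤ m) eq sx≤m)
    i : Fin (m ∸ 1)
    i = fromℕ< p<m-1
    i≡p : toℕ i ≡ p
    i≡p = Fin.toℕ-fromℕ< p<m-1
    hit-count : ∀ q → q ≡ p → count (x ∷ xs) (2 + q) ≡ suc (count xs (2 + q))
    hit-count q refl rewrite dec-true (s x ≟ 2 + p) eq = refl
    at : triangle (suc p) + triangle (suc (toℕ i)) * count xs (2 + toℕ i)
        ≤ triangle (suc (toℕ i)) * count (x ∷ xs) (2 + toℕ i)
    at = ≤-reflexive (trans (cong (λ q → triangle (suc q) + triangle (suc (toℕ i)) * count xs (2 + toℕ i)) (sym i≡p))
           (trans (sym (*-suc (triangle (suc (toℕ i))) _))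
               (cong (triangle (suc (toℕ i)) *_) (sym (hit-count (toℕ i) i≡p)))))

-- The hypothesis over ℕ

-- Rational identities are proved on unnormalised fractions, where cross-multiplication turns them
-- into integer equations.
fromℕ-ᵘ : ∀ a → ℚ.toℚᵘ (fromℕ a) ℚᵘ.≃ mkℚᵘ (pos a) 0
fromℕ-ᵘ a = ℚ.toℚᵘ-fromℚᵘ (mkℚᵘ (pos a) 0)

fromℕ-+ : ∀ a b → fromℕ (a + b) ≡ fromℕ a ℚ.+ fromℕ b
fromℕ-+ a b = ℚ.toℚᵘ-injective (begin
  ℚ.toℚᵘ (fromℕ (a + b))                      ≈⟨ fromℕ-ᵘ (a + b) ⟩
  mkℚᵘ (pos (a + b)) 0
      ≈⟨ *≡* (cong (ℤ._* pos 1)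
      (sym (cong₂ ℤ._+_ (ℤ.*-identityʳ (pos a)) (ℤ.*-identityʳ (pos b))))) ⟩
  mkℚᵘ (pos a) 0 ℚᵘ.+ mkℚᵘ (pos b) 0              ≈⟨ ℚᵘ.+-cong (fromℕ-ᵘ a) (fromℕ-ᵘ b) ⟨
  ℚ.toℚᵘ (fromℕ a) ℚᵘ.+ ℚ.toℚᵘ (fromℕ b)      ≈⟨ ℚ.toℚᵘ-homo-+ (fromℕ a) (fromℕ b) ⟨
  ℚ.toℚᵘ (fromℕ a ℚ.+ fromℕ b)                ∎)
  where open ℚᵘ.≃-Reasoning

fromℕ-* : ∀ a b → fromℕ (a * b) ≡ fromℕ a ℚ.* fromℕ b
fromℕ-* a b = ℚ.toℚᵘ-injective (begin
  ℚ.toℚᵘ (fromℕ (a * b))                      ≈⟨ fromℕ-ᵘ (a * b) ⟩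
  mkℚᵘ (pos (a * b)) 0                          ≈⟨ *≡* (cong (ℤ._* pos 1) (ℤ.pos-* a b)) ⟩
  mkℚᵘ (pos a) 0 ℚᵘ.* mkℚᵘ (pos b) 0              ≈⟨ ℚᵘ.*-cong (fromℕ-ᵘ a) (fromℕ-ᵘ b) ⟨
  ℚ.toℚᵘ (fromℕ a) ℚᵘ.* ℚ.toℚᵘ (fromℕ b)      ≈⟨ ℚ.toℚᵘ-homo-* (fromℕ a) (fromℕ b) ⟨
  ℚ.toℚᵘ (fromℕ a ℚ.* fromℕ b)                ∎)
  where open ℚᵘ.≃-Reasoning

fromℕ-cancel-≤ : ∀ {a b} → fromℕ a ℚ.≤ fromℕ b → a ≤ b
fromℕ-cancel-≤ {a} {b} le with ℚᵘ.≤-respˡ-≃ (fromℕ-ᵘ a) (ℚᵘ.≤-respʳ-≃ (fromℕ-ᵘ b) (ℚ.toℚᵘ-mono-≤ le))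
... | *≤* a≤b = ℤ.drop‿+≤+ (ℤ.*-cancelʳ-≤-pos (pos a) (pos b) (pos 1) a≤b)

fromℕ-∑ : ∀ {n} (f : Fin n → ℕ) → fromℕ (∑ᶠ f) ≡ ∑ℚ (fromℕ ∘ f)
fromℕ-∑ {zero}  f = refl
fromℕ-∑ {suc n} f = trans (fromℕ-+ (f zero) _) (cong (fromℕ (f zero) ℚ.+_) (fromℕ-∑ (f ∘ suc)))

coeff-triangle : ∀ s → coeff (2 + s) ≡ fromℕ (triangle (suc s))
coeff-triangle s = ℚ.toℚᵘ-injective (begin
  ℚ.toℚᵘ ((a ℚ.- b) ℚ.+ 1ℚ)                                    ≈⟨ ℚ.toℚᵘ-homo-+ (a ℚ.- b) 1ℚ ⟩
  ℚ.toℚᵘ (a ℚ.- b) ℚᵘ.+ one                                    ≈⟨ ℚᵘ.+-congˡ one (ℚ.toℚᵘ-homo-+ a (ℚ.- b)) ⟩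
  (ℚ.toℚᵘ a ℚᵘ.+ ℚ.toℚᵘ (ℚ.- b)) ℚᵘ.+ one                      ≈⟨ ℚᵘ.+-congˡ one (ℚᵘ.+-cong a≃ -b≃) ⟩
  (mkℚᵘ (pos A) 1 ℚᵘ.- mkℚᵘ (pos B) 1) ℚᵘ.+ one
      ≈⟨ *≡* (trans (regroup (pos A) (pos B))
      (trans (cong (λ x → pos 2 ℤ.* (x ℤ.- pos B)) identityᶻ) (cancel (pos T) (pos B)))) ⟩
  mkℚᵘ (pos T) 0                                                 ≈⟨ fromℕ-ᵘ T ⟨
  ℚ.toℚᵘ (fromℕ T)                                             ∎)
  where
  open ℚᵘ.≃-Reasoning
  A = (2 + s) ^ 2
  B = 3 * (2 + s)
  T = triangle (suc s)
  a = pos A ℚ./ 2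
  b = pos B ℚ./ 2
  one = mkℚᵘ (pos 1) 0
  a≃ : ℚ.toℚᵘ a ℚᵘ.≃ mkℚᵘ (pos A) 1
  a≃ = ℚ.toℚᵘ-fromℚᵘ (mkℚᵘ (pos A) 1)
  -b≃ : ℚ.toℚᵘ (ℚ.- b) ℚᵘ.≃ ℚᵘ.- mkℚᵘ (pos B) 1
  -b≃ = ℚᵘ.≃-trans (ℚ.toℚᵘ-homo‿- b) (ℚᵘ.-‿cong (ℚ.toℚᵘ-fromℚᵘ (mkℚᵘ (pos B) 1)))
  double : ∀ s → 2 * triangle s + s ≡ s * s
  double zero    = refl
  double (suc s) = trans (eq₁ s (triangle s)) (trans (cong (_+ (s + suc s)) (double s)) (eq₂ s))
    where
    eq₁ : ∀ s t → 2 * (s + t) + suc s ≡ (2 * t + s) + (s + suc s)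
    eq₁ = solve-∀
    eq₂ : ∀ s → s * s + (s + suc s) ≡ suc s * suc s
    eq₂ = solve-∀
  -- With `p = s + 2` this is `p² + 2 = 2T + 3p`, the formula for the coefficient freed of fractions
  -- and subtraction.
  identity : A + 2 ≡ 2 * T + B
  identity = trans (eq₁ s) (trans (cong (_+ (2 * s + (2 + 2 * (2 + s)))) (sym (double s))) (eq₂ s (triangle s)))
    where
    eq₁ : ∀ s → (2 + s) * ((2 + s) * 1) + 2 ≡ s * s + (2 * s + (2 + 2 * (2 + s)))
    eq₁ = solve-∀
    eq₂ : ∀ s t → (2 * t + s) + (2 * s + (2 + 2 * (2 + s))) ≡ 2 * (s + t) + 3 * (2 + s)
    eq₂ = solve-∀
  identityᶻ : pos A ℤ.+ pos 2 ≡ pos 2 ℤ.* pos T ℤ.+ pos B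
  identityᶻ = trans (cong pos identity) (cong (ℤ._+ pos B) (ℤ.pos-* 2 T))
  -- The 4 is the unreduced denominator 2 · 2 of the difference of two halves.
  regroup : ∀ A B → ((A ℤ.* pos 2 ℤ.+ (ℤ.- B) ℤ.* pos 2) ℤ.* pos 1 ℤ.+ pos 1 ℤ.* pos 4) ℤ.* pos 1
      ≡ pos 2 ℤ.* ((A ℤ.+ pos 2) ℤ.- B)
  regroup = ℤ.solve-∀
  cancel : ∀ T B → pos 2 ℤ.* ((pos 2 ℤ.* T ℤ.+ B) ℤ.- B) ≡ T ℤ.* pos 4
  cancel = ℤ.solve-∀

∑-hypothesis : ∀ {k₁} m (k : ℕ → ℕ) →
               fromℕ k₁ ℚ.- ∑₂ m (λ p → coeff p ℚ.* fromℕ (k p)) ℚ.≥ 0ℚ →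
               ∑ᶠ {m ∸ 1} (λ i → triangle (suc (toℕ i)) * k (2 + toℕ i)) ≤ k₁
∑-hypothesis {k₁} m k hyp = fromℕ-cancel-≤ (ℚ.≤-trans (ℚ.≤-reflexive S≡) S≤k₁)
  where
  S = ∑₂ m (λ p → coeff p ℚ.* fromℕ (k p))
  S≡ : fromℕ (∑ᶠ {m ∸ 1} (λ i → triangle (suc (toℕ i)) * k (2 + toℕ i))) ≡ S
  S≡ = trans (fromℕ-∑ {m ∸ 1} _) (∑ℚ-cong {m ∸ 1} λ i →
         trans (fromℕ-* (triangle (suc (toℕ i))) _) (cong (ℚ._* fromℕ (k (2 + toℕ i))) (sym (coeff-triangle (toℕ i)))))
  S≤k₁ : S ℚ.≤ fromℕ k₁
  S≤k₁ = begin
    S                               ≡⟨ ℚ.+-identityˡ S ⟨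
    0ℚ ℚ.+ S                        ≤⟨ ℚ.+-monoˡ-≤ S hyp ⟩
    (fromℕ k₁ ℚ.- S) ℚ.+ S          ≡⟨ ℚ.+-assoc (fromℕ k₁) (ℚ.- S) S ⟩
    fromℕ k₁ ℚ.+ (ℚ.- S ℚ.+ S)      ≡⟨ cong (fromℕ k₁ ℚ.+_) (ℚ.+-inverseˡ S) ⟩
    fromℕ k₁ ℚ.+ 0ℚ                 ≡⟨ ℚ.+-identityʳ _ ⟩
    fromℕ k₁                        ∎
    where open ℚ.≤-Reasoning

-- The game

module _ {n : ℕ} (G : Graph n) where
  open Graph G using (Adj)

  module _ (N k : ℕ) where
    open Strategy Adj (Graph.irrefl G refl) N

    private
      tokens : (Fin n → ℕ) → Fin n → ℕ
      tokens marks v = k ∸ marks v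

    Safe⇒tokens : ∀ {marks Ps Ts v} → Safe (tokens marks) Ps Ts → Covered v Ps Ts → marks v < k
    Safe⇒tokens {marks} {v = v} s v∈ = m∸n≢0⇒n<m λ eq → <-irrefl (sym eq) (positive s v∈)
      where
      positive : ∀ {g Ps Ts} → Safe g Ps Ts → Covered v Ps Ts → 0 < g v
      positive s (inj₂ v∈) = Settled⇒positive (Safe.settled s) v∈
      positive {g} {P₀ ∷ Ps} s (inj₁ v∈) with find v∈
      ... | P , P∈ , v∈P = ≤-trans z<s
          (≤-trans (All.lookup (Safe.rich s) P∈ (v ∷ []) 0 (Sublist.from∈ v∈P) refl)
          (≤-reflexive (+-identityʳ (g v))))

    tokens-mark : ∀ V marks v → tokens marks v ≤ suc (tokens (mark V marks) v)
    tokens-mark V marks v with Vec.lookup V v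
    ... | true  = ≤-trans (m≤n+m∸n (tokens marks v) 1)
        (s≤s (≤-reflexive (trans (∸-+-assoc k (marks v) 1) (cong (k ∸_) (+-comm (marks v) 1)))))
    ... | false = n≤1+n _

    tokens-unmarked : ∀ V marks {v} → ¬ v Subset.∈ V → tokens marks v ≤ tokens (mark V marks) v
    tokens-unmarked V marks {v} v∉V with Vec.lookup V v in eq
    ... | true  = contradiction (lookup⇒[]= v V eq) v∉V
    ... | false = ≤-refl

    -- The fuel bounds the number of vertices in Bob's lists, which every answer makes smaller.
    Safe⇒BobWins : ∀ fuel {Ps Ts U marks} → size Ps Ts < fuel → Safe (tokens marks) Ps Ts →
                   (∀ {v} → v Subset.∈ U → Covered v Ps Ts) → BobWins G (λ _ → k) U marks
    Safe⇒BobWins (suc fuel) {Ps} {Ts} {U} {marks} size< s cover = bobWins (Safe⇒tokens {marks} s ∘ cover) respond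
      where
      respond : ∀ V → Subset.Nonempty V → V Subset.⊆ U →
                ∃[ X ] X Subset.⊆ V × Independent G X × BobWins G (λ _ → k) (U ─ X) (mark V marks)
      respond V (v , v∈V) V⊆U = X , All.lookup legal ∘ X⇒chosen , (λ u∈ w∈ → indep (X⇒chosen u∈) (X⇒chosen w∈))
                              , Safe⇒BobWins fuel (<-≤-trans shrink (≤-pred size<)) safe stillCovered
        where
        open Round (Subset._∈ V) (_∈? V) (tokens marks) (tokens (mark V marks))
            (tokens-mark V marks) (tokens-unmarked V marks)
        open Reply (reply s v∈V (cover (V⊆U v∈V))) renaming (cover to cover′)
        chosen? : ∀ u → Dec (u ∈ chosen)
        chosen? u = DecMembership._∈?_ Fin._≟_ u chosen
        X : Subset n
        X = Vec.tabulate (does ∘ chosen?)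
        X⇒chosen : ∀ {u} → u Subset.∈ X → u ∈ chosen
        X⇒chosen = ∈-tabulate⁻ chosen?
        stillCovered : ∀ {u} → u Subset.∈ U ─ X → Covered u Ps′ Ts′
        stillCovered u∈ with cover′ (cover (p─q⊆p U X u∈))
        ... | inj₁ u∈chosen = contradiction (∈-tabulate⁺ chosen? u∈chosen) (x∈p─q⇒x∉q u∈)
        ... | inj₂ covered  = covered

  -- Alice marks every uncoloured vertex in every round, so round t is a colour class.
  choosable⇒colourable : ∀ {k} → OnlineChoosable G (λ _ → k) → Colourable G k
  choosable⇒colourable {k} win with go k ≤-refl win (λ _ → refl)
    where
    go : ∀ {U marks t} fuel → k ≤ t + fuel → BobWins G (λ _ → k) U marks → (∀ {v} → v Subset.∈ U → marks v ≡ t) →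
         Σ[ c ∈ (Fin n → ℕ) ] (∀ {v} → v Subset.∈ U → t ≤ c v × c v < k) ×
                              (∀ {u v} → u Subset.∈ U → v Subset.∈ U → Adj u v → c u ≢ c v)
    go {U} {marks} {t} fuel k≤ (bobWins alive respond) marked with nonempty? U
    ... | no empty = (λ _ → 0) , (λ v∈ → contradiction (_ , v∈) empty) , λ u∈ → contradiction (_ , u∈) empty
    ... | yes (w , w∈) with subst (_< k) (marked w∈) (alive w∈) | fuel
    -- The uncoloured `w` carries `t` marks and has some left, so `t < k`, and the fuel, at least
    -- `k − t`, cannot be 0.
    ...   | t<k | zero     = contradiction t<k (≤⇒≯ (≤-trans k≤ (≤-reflexive (+-identityʳ t))))
    ...   | t<k | suc fuel with respond U (w , w∈) id
    ...     | X , X⊆U , X-indep , win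
        with go {t = suc t} fuel (≤-trans k≤ (≤-reflexive (+-suc t fuel))) win marked′
      where
      marked′ : ∀ {v} → v Subset.∈ U ─ X → mark U marks v ≡ suc t
      marked′ {v} v∈ rewrite []=⇒lookup (p─q⊆p U X v∈) = cong suc (marked (p─q⊆p U X v∈))
    ...       | c , range , proper = c′ , range′ , proper′
      where
      c′ : Fin n → ℕ
      c′ v with v ∈? X
      ... | yes _ = t
      ... | no _  = c v
      range′ : ∀ {v} → v Subset.∈ U → t ≤ c′ v × c′ v < k
      range′ {v} v∈ with v ∈? X
      ... | yes _  = ≤-refl , t<k
      ... | no v∉X = let lo , hi = range (x∈p∧x∉q⇒x∈p─q v∈ v∉X) in <⇒≤ lo , hi
      proper′ : ∀ {u v} → u Subset.∈ U → v Subset.∈ U → Adj u v → c′ u ≢ c′ v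
      proper′ {u} {v} u∈ v∈ adj with u ∈? X | v ∈? X
      ... | yes u∈X | yes v∈X = contradiction adj (X-indep u∈X v∈X)
      -- Vertices coloured in later rounds get colours above `t`.
      ... | yes u∈X | no v∉X  = <⇒≢ (proj₁ (range (x∈p∧x∉q⇒x∈p─q v∈ v∉X)))
      ... | no u∉X  | yes v∈X = <⇒≢ (proj₁ (range (x∈p∧x∉q⇒x∈p─q u∈ u∉X))) ∘ sym
      ... | no u∉X  | no v∉X  = proper (x∈p∧x∉q⇒x∈p─q u∈ u∉X) (x∈p∧x∉q⇒x∈p─q v∈ v∉X) adj
  ... | c , range , proper = (λ v → fromℕ< (proj₂ (range (∈⊤ {x = v})))) ,
    λ adj eq → proper ∈⊤ ∈⊤ adj (trans (sym (Fin.toℕ-fromℕ< _)) (trans (cong toℕ eq) (Fin.toℕ-fromℕ< _)))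

  -- Complete multipartite graphs: chromatic number and initial position

  module _ (M : CompleteMultipartite G) where
    open CompleteMultipartite M

    adjacent : ∀ {u v} → part u ≢ part v → Adj u v
    adjacent = Equivalence.from (adj⇔ _ _)

    separate : ∀ {u v} → Adj u v → part u ≢ part v
    separate = Equivalence.to (adj⇔ _ _)

    -- For the lower bound, representatives of the parts are pairwise adjacent, so a proper
    -- colouring is injective on them.
    chromaticNumber : IsChromaticNumber G #parts
    chromaticNumber = (part , separate) , λ j (c , proper) → Fin.injective⇒≤ {f = c ∘ proj₁ ∘ nonempty} λ {i} {i′} eq →
      decidable-stable (i Fin.≟ i′) λ i≢i′ → proper (adjacent λ same →
        i≢i′ (trans (sym (proj₂ (nonempty i))) (trans same (proj₂ (nonempty i′))))) eq

    choosable : ∀ {m} → IsIndependenceNumber G m →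
              fromℕ (#partsOfSize 1) ℚ.- ∑₂ m (λ p → coeff p ℚ.* fromℕ (#partsOfSize p)) ℚ.≥ 0ℚ →
              OnlineChoosable G (λ _ → #parts)
    choosable {m} (_ , α≤m) hyp = Safe⇒BobWins m #parts (suc (size big Ts)) ≤-refl initial covered
      where
      open Strategy Adj (Graph.irrefl G refl) m
      inPart? : ∀ i v → Dec (part v ≡ i)
      inPart? i v = part v Fin.≟ i
      members : Fin #parts → List (Fin n)
      members i = filter (inPart? i) (allFin n)
      sizeOf : Fin #parts → ℕ
      sizeOf i = ∣ partiteSet i ∣
      length-members : ∀ i → length (members i) ≡ sizeOf i
      length-members i = length-filter-tabulate (inPart? i) id
      members-indep : ∀ i → Independentₗ (members i)
      members-indep i u∈ v∈ adj = separate adj (trans (inPart u∈) (sym (inPart v∈)))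
        where
        inPart : ∀ {v} → v ∈ members i → part v ≡ i
        inPart = proj₂ ∘ ∈-filter⁻ (inPart? i) {xs = allFin n}
      sizeOf≤m : ∀ i → sizeOf i ≤ m
      sizeOf≤m i = α≤m (sizeOf i) (partiteSet i ,
          (λ u∈ v∈ adj → separate adj (trans (∈-tabulate⁻ (inPart? i) u∈)
          (sym (∈-tabulate⁻ (inPart? i) v∈)))) , refl)
      large? : ∀ (P : List (Fin n)) → Dec (2 ≤ length P)
      large? P = 2 ≤? length P
      parts big small : List (List (Fin n))
      parts = map members (allFin #parts)
      big   = filter large? parts
      small = filter (¬? ∘ large?) parts
      Ts : List (ℕ × Fin n)
      Ts = label m (concat small)
      small+big : length small + length big ≡ #parts
      small+big = trans (length-filter-¬ large? parts) (trans (length-map members (allFin #parts)) (length-tabulate id))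
      singles≤small : length (concat small) ≤ length small
      singles≤small = length-concat (All.map (λ ¬2≤ → ≤-pred (≰⇒> ¬2≤)) (All.all-filter (¬? ∘ large?) parts))
      triangles≤small : ∑ (λ P → triangle (length P ∸ 1)) big ≤ length small
      triangles≤small = begin
        ∑ (λ P → triangle (length P ∸ 1)) big                      ≤⟨ ∑-filter large? _ parts ⟩
        ∑ (λ P → triangle (length P ∸ 1)) parts                    ≡⟨ ∑-map (allFin #parts) ⟩
        ∑ (λ i → triangle (sizeOf i ∸ 1)) (allFin #parts)          ≤⟨ ∑-bySize sizeOf m (allFin #parts) (All.universal sizeOf≤m _) ⟩
        ∑ᶠ {m ∸ 1} (λ i → triangle (suc (toℕ i)) * length (filter (λ x → sizeOf x ≟ 2 + toℕ i) (allFin #parts)))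
                                                                   ≤⟨ ∑ᶠ-mono {m ∸ 1} (λ i → *-monoʳ-≤ (triangle (suc (toℕ i)))
                                                                       (≤-reflexive (length-filter-tabulate (λ x → sizeOf x ≟ 2 + toℕ i) id))) ⟩
        ∑ᶠ {m ∸ 1} (λ i → triangle (suc (toℕ i)) * #partsOfSize (2 + toℕ i))
                                                                   ≤⟨ ∑-hypothesis m #partsOfSize hyp ⟩
        #partsOfSize 1                                             ≡⟨ length-filter-tabulate (λ x → sizeOf x ≟ 1) id ⟨
        length (filter (λ x → sizeOf x ≟ 1) (allFin #parts))
            ≤⟨ length-filter-map _ (¬? ∘ large?) members
            (λ {i} one → <⇒≱ (≤-reflexive (cong suc (trans (length-members i) one)))) (allFin #parts) ⟩
        length small                                               ∎
        where
        open ≤-Reasoning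
        ∑-map : ∀ is → ∑ (λ P → triangle (length P ∸ 1)) (map members is) ≡ ∑ (λ i → triangle (sizeOf i ∸ 1)) is
        ∑-map []       = refl
        ∑-map (i ∷ is) = cong₂ _+_ (cong (λ x → triangle (x ∸ 1)) (length-members i)) (∑-map is)
      -- A big part costs at most `suc j` plus its triangle, a single only `j`. The unit saved on
      -- each small part pays for the triangles; this is where the hypothesis enters.
      bound≤ : ∀ j → bound big Ts j ≤ suc j * #parts
      bound≤ j = begin
        bound big Ts j
          ≤⟨ +-mono-≤ (demands (All.all-filter large? parts)) (singles (concat small)) ⟩
        (length big * suc j + ∑ (λ P → triangle (length P ∸ 1)) big) + length (concat small) * j
          ≤⟨ +-mono-≤ (+-monoʳ-≤ (length big * suc j) triangles≤small) (*-monoˡ-≤ j singles≤small) ⟩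
        (length big * suc j + length small) + length small * j
          ≡⟨ eq (length big) (length small) j ⟩
        suc j * (length small + length big)
          ≡⟨ cong (suc j *_) small+big ⟩
        suc j * #parts ∎
        where
        open ≤-Reasoning
        eq : ∀ b s j → (b * suc j + s) + s * j ≡ suc j * (s + b)
        eq = solve-∀
        eq′ : ∀ x t y z → (x + t) + (y + z) ≡ (x + y) + (t + z)
        eq′ = solve-∀
        demands : ∀ {Ps} → All (λ P → 2 ≤ length P) Ps →
                  ∑ (λ P → demand (length P) j) Ps ≤ length Ps * suc j + ∑ (λ P → triangle (length P ∸ 1)) Ps
        demands [] = z≤n
        demands {P@(_ ∷ P′) ∷ Ps} (_ ∷ larges) = ≤-trans (+-mono-≤ (demand-triangle (length P′) j) (demands larges))
          (≤-reflexive (eq′ (suc j) (triangle (length P′)) (length Ps * suc j) _))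
        singles : ∀ us → ∑ (λ t → j ⊓ level t) (label m us) ≤ length us * j
        singles []       = z≤n
        singles (_ ∷ us) = +-mono-≤ (m⊓n≤m j m) (singles us)
      bigProper : All Proper big
      bigProper = All.tabulate λ P∈ → isProper (∈-filter⁻ large? P∈)
        where
        isProper : ∀ {P} → P ∈ parts × 2 ≤ length P → Proper P
        isProper (P∈ , 2≤) with ∈-map⁻ members P∈
        ... | i , _ , refl = proper 2≤ (≤-trans (≤-reflexive (length-members i)) (sizeOf≤m i)) (members-indep i)
      initial : Safe (λ _ → #parts) big Ts
      initial = record
        { allProper = bigProper
        ; rich = All.universal (λ P Q j _ len → ≤-trans (bound≤ j)
            (≤-reflexive (sym (trans (∑-const {xs = Q} (All.universal (λ _ → refl) Q))
            (cong (_* #parts) len))))) big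
        ; settled = Settled-const (concat small) 0 (All.universal (λ _ → ≤-refl) _) fits
        ; descending = subst (Descending m) (++-identityʳ Ts) (Descending-const (concat small) []) }
        where
        fits : rounds big m + (0 + length (concat small)) ≤ #parts
        fits = begin
          rounds big m + length (concat small)       ≤⟨ +-mono-≤ (≤-reflexive (rounds-N bigProper)) singles≤small ⟩
          length big * 1 + length small              ≡⟨ cong (_+ length small) (*-identityʳ (length big)) ⟩
          length big + length small                  ≡⟨ +-comm (length big) _ ⟩
          length small + length big                  ≡⟨ small+big ⟩
          #parts                                     ∎
          where open ≤-Reasoning
      member : ∀ {i} → members i ∈ parts
      member {i} = ∈-map⁺ members (∈-allFin i)
      v∈members : ∀ v → v ∈ members (part v)
      v∈members v = ∈-filter⁺ (inPart? (part v)) (∈-allFin v) refl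
      covered : ∀ {v} → v Subset.∈ ⊤ → Covered v big Ts
      covered {v} _ with large? (members (part v))
      ... | yes large = inj₁ (lose (∈-filter⁺ large? member large) (v∈members v))
      ... | no ¬large = inj₂ (Any.map⁺ (∈-concat⁺′ (v∈members v) (∈-filter⁺ (¬? ∘ large?) member ¬large)))

theorem7 : ∀ {n : ℕ} (G : Graph n) (M : CompleteMultipartite G) (m : ℕ) →
    let k = CompleteMultipartite.#partsOfSize M in
    IsIndependenceNumber G m → 2 ≤ m →
    fromℕ (k 1) ℚ.- ∑₂ m (λ p → coeff p ℚ.* fromℕ (k p)) ℚ.≥ 0ℚ →
    OnlineChromaticChoosable G
theorem7 G M m α≡m _ hyp =
    #parts , (choosable G M α≡m hyp , λ j → proj₂ (chromaticNumber G M) j ∘ choosable⇒colourable G) , chromaticNumber G M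
  where open CompleteMultipartite M using (#parts)
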